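{- Let $0\neq\lambda\in\mathbb{R}$, let $r\ge 2$, $k_{1},k_{2},\dots,k_{r}\in\mathbb{Z}$ and $n\ge 0$. Then \begin{align*} \beta_{n,\lambda}^{(k_{1},k_{2},\dots,k_{r})}(x) &= r \sum_{k=0}^{n}\sum_{l=0}^{k}\sum_{n_{r}=1}^{l+1}\sum_{m=0}^{\infty} \binom{k_{r}+m-1}{m}\binom{k}{l}\binom{n}{k}(-1)^{m}\\ &\quad\times\frac{n_{r}!\,(-1)^{l-n_{r}-1} S_{2}(l+1,n_{r})}{l+1}\, n_{r}^{ -k_{r}-m}\,\beta_{n-k,\lambda}\,\beta_{k-l,\lambda}^{(k_{1},\dots,k_{r-2},k_{r-1}-m)}(x). \end{align*}
   Context: All generating functions are formal power series in $t$. For $0\neq\lambda\in\mathbb{R}$, $e_{\lambda}^{x}(t)=(1+\lambda t)^{x/\lambda}$ and $e_\lambda(t)=(1+\lambda t)^{1/\lambda}$. For $s\ge1$ and $k_1,\dots,k_s\in\mathbb{Z}$ the multiple polylogarithm is $\mathrm{Li}_{k_{1},\dots,k_{s}}(x)=\sum_{0<n_{1}<\cdots<n_{s}}\frac{x^{n_{s}}}{n_{1}^{k_{1}}\cdots n_{s}^{k_{s}}}$, and the degenerate multi-poly-Bernoulli polynomials (with $s$ indices) are defined by $$\frac{s!\,\mathrm{Li}_{k_{1},\dots,k_{s}}(1-e^{ -t})}{\big(e_{\lambda}(t)-1\big)^{s}}e_{\lambda}^{x}(t)=\sum_{n=0}^{\infty}\beta_{n,\lambda}^{(k_{1},\dots,k_{s})}(x)\frac{t^{n}}{n!}.$$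 $\beta_{n,\lambda}$ are Carlitz's degenerate Bernoulli numbers: $\frac{t}{e_\lambda(t)-1}=\sum_{n\ge0}\beta_{n,\lambda}\frac{t^n}{n!}$. $S_2(n,k)$ are the Stirling numbers of the second kind, $\frac{1}{k!}(e^t-1)^k=\sum_{n\ge k}S_2(n,k)\frac{t^n}{n!}$. For $k\in\mathbb{Z}$, $\binom{k+m-1}{m}$ denotes the generalized binomial coefficient $\frac{(k+m-1)(k+m-2)\cdots k}{m!}$.
   Formalization: For k_r ≥ 1 the sum over m diverges (n=0, r=2, k_r=1 gives 2·Σ(-1)^m), so each m-series is taken as Euler's sum (value at z=1 of the rational function Σ a_m z^m); for k_r ≤ 0 ordinary convergence is also shown. -}

module Defs where

open import Algebra.Bundles using (CommutativeRing; Semiring)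
import Algebra.Definitions.RawSemiring as RawSemiringDefs
import Algebra.Properties.Ring as RingProperties
import Algebra.Properties.CommutativeSemigroup as CSProperties
open import Data.Empty using (⊥-elim)
open import Data.Integer.Base as ℤ using (ℤ; +_; -[1+_])
open import Data.List.Base using (List; []; _∷_; foldr)
open import Data.Nat.Base as ℕ using (ℕ; zero; suc; _!; NonZero; z≤n; s≤s)
import Data.Nat.Properties as ℕₚ
open import Data.Product.Base using (∃; _×_; _,_; proj₁; proj₂)
open import Data.Sum.Base using (_⊎_; inj₁; inj₂)
open import Data.Vec.Functional using (Vector; init; last)
open import Level using (Level; _⊔_) renaming (suc to lsuc)
open import Relation.Binary.Core using (Rel)
open import Relation.Binary.PropositionalEquality as ≡ using (_≡_)
open import Relation.Binary.Structures using (IsStrictPartialOrder)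
import Relation.Binary.Reasoning.Setoid as SetoidReasoning
open import Relation.Nullary using (¬_)

-- The axioms of ℝ (a Cauchy-complete Archimedean ordered field), in the form
-- which is also met by constructive real numbers: `x # 0#` plays the role of
-- "x ≠ 0" and classically coincides with it.
record RealField (c ℓ₁ ℓ₂ : Level) : Set (lsuc (c ⊔ ℓ₁ ⊔ ℓ₂)) where
  infix 4 _<_ _#_ _⟶_
  field
    commutativeRing : CommutativeRing c ℓ₁

  open CommutativeRing commutativeRing public
  open RawSemiringDefs (Semiring.rawSemiring semiring) public using (_^_) renaming (_×_ to _·_)

  field
    _<_                  : Rel Carrier ℓ₂
    isStrictPartialOrder : IsStrictPartialOrder _≈_ _<_

  _#_ : Rel Carrier ℓ₂
  x # y = (x < y) ⊎ (y < x)

  _⟶_ : (ℕ → Carrier) → Carrier → Set (c ⊔ ℓ₂)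
  f ⟶ L = ∀ ε → 0# < ε → ∃ λ N → ∀ n → N ℕ.≤ n → (f n < L + ε) × (L < f n + ε)

  Cauchy : (ℕ → Carrier) → Set (c ⊔ ℓ₂)
  Cauchy f = ∀ ε → 0# < ε → ∃ λ N → ∀ m n → N ℕ.≤ m → N ℕ.≤ n → f m < f n + ε

  field
    <-cotrans     : ∀ {x y} → x < y → ∀ z → (x < z) ⊎ (z < y)
    tight         : ∀ {x y} → ¬ (x # y) → x ≈ y
    +-monoˡ-<     : ∀ z {x y} → x < y → z + x < z + y
    *-pos         : ∀ {x y} → 0# < x → 0# < y → 0# < x * y
    0<1           : 0# < 1#
    recip         : ∀ x → x # 0# → Carrier
    recip-inverse : ∀ x (x#0 : x # 0#) → x * recip x x#0 ≈ 1#
    archimedean   : ∀ x → ∃ λ n → x < n · 1#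
    complete      : ∀ f → Cauchy f → ∃ λ L → f ⟶ L

  open IsStrictPartialOrder isStrictPartialOrder public
    using (<-respˡ-≈; <-respʳ-≈)
    renaming (irrefl to <-irrefl; trans to <-trans)

module DegenerateBernoulli {c ℓ₁ ℓ₂} (R : RealField c ℓ₁ ℓ₂) where
  open RealField R
  open RingProperties ring using (-0#≈0#)

  0<1+n : ∀ n → 0# < suc n · 1#
  0<1+n zero    = <-respʳ-≈ (sym (+-identityʳ 1#)) 0<1
  0<1+n (suc n) = <-trans (0<1+n n)
    (<-respʳ-≈ (+-comm _ _) (<-respˡ-≈ (+-identityʳ _) (+-monoˡ-< (suc n · 1#) 0<1)))

  -1#0 : (- 1#) # 0#
  -1#0 = inj₁ (<-respˡ-≈ (+-identityʳ (- 1#)) (<-respʳ-≈ (-‿inverseˡ 1#) (+-monoˡ-< (- 1#) 0<1)))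

  fromℕ : ℕ → Carrier
  fromℕ n = n · 1#

  fromℤ : ℤ → Carrier
  fromℤ (+ n)    = fromℕ n
  fromℤ -[1+ n ] = - fromℕ (suc n)

  fromℕ#0 : ∀ n → .{{NonZero n}} → fromℕ n # 0#
  fromℕ#0 (suc n) = inj₂ (0<1+n n)

  1/_ : ∀ n → .{{NonZero n}} → Carrier
  1/ n = recip (fromℕ n) (fromℕ#0 n)

  invFact : ℕ → Carrier
  invFact n = (1/ (n !)) {{ℕₚ._!≢0 n}}

  zpow : ∀ a → a # 0# → ℤ → Carrier
  zpow a a#0 (+ n)    = a ^ n
  zpow a a#0 -[1+ n ] = recip a a#0 ^ suc n

  infixr 8 _^ℤ_ -1^_

  _^ℤ_ : ∀ n → .{{NonZero n}} → ℤ → Carrier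
  n ^ℤ z = zpow (fromℕ n) (fromℕ#0 n) z

  -1^_ : ℤ → Carrier
  -1^ z = zpow (- 1#) -1#0 z

  ∑< : ℕ → (ℕ → Carrier) → Carrier
  ∑< zero    f = 0#
  ∑< (suc n) f = f 0 + ∑< n (λ i → f (suc i))

  fallingFactorial : Carrier → ℕ → Carrier
  fallingFactorial a zero    = 1#
  fallingFactorial a (suc m) = a * fallingFactorial (a - 1#) m

  binom : Carrier → ℕ → Carrier
  binom a m = fallingFactorial a m * invFact m

  -- Formal power series: f n is the coefficient of tⁿ.
  Series : Set c
  Series = ℕ → Carrier

  infix 4 _≋_
  infixl 6 _-ₛ_
  infixl 7 _*ₛ_ _∙ₛ_
  infixr 8 _^ₛ_

  _≋_ : Rel Series ℓ₁
  f ≋ g = ∀ n → f n ≈ g n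

  1ₛ : Series
  1ₛ zero    = 1#
  1ₛ (suc n) = 0#

  tₛ : Series
  tₛ zero    = 0#
  tₛ (suc n) = 1ₛ n

  _-ₛ_ : Series → Series → Series
  (f -ₛ g) n = f n - g n

  _∙ₛ_ : Carrier → Series → Series
  (a ∙ₛ f) n = a * f n

  _*ₛ_ : Series → Series → Series
  (f *ₛ g) n = ∑< (suc n) λ i → f i * g (n ℕ.∸ i)

  _^ₛ_ : Series → ℕ → Series
  f ^ₛ zero  = 1ₛ
  f ^ₛ suc n = f *ₛ f ^ₛ n

  -- The composite Σ_N f_N u(t)ᴺ, for u with zero constant term: then uᴺ does not
  -- contribute to the coefficient of tⁿ when N > n.
  compose : Series → Series → Series
  compose f u n = ∑< (suc n) λ N → f N * (u ^ₛ N) n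

  -- 1/g = Σ_j (1 - g)ʲ, for g with constant term 1.
  inverseₛ : Series → Series
  inverseₛ g = compose (λ _ → 1#) (1ₛ -ₛ g)

  shift : ℕ → Series → Series
  shift s f n = f (s ℕ.+ n)

  -- The quotient f / dˢ, for f of order ≥ s and d = t + O(t²):
  -- (f / tˢ) · (1 / (d / t))ˢ. See `quotient-spec`.
  quotient : Series → Series → ℕ → Series
  quotient f d s = shift s f *ₛ inverseₛ (shift 1 d) ^ₛ s

  expₛ : Carrier → Series
  expₛ a n = a ^ n * invFact n

  egf : Series → Series
  egf a n = a n * invFact n

  -- n! [tⁿ] f, so that f = Σ (egfCoeff f n) tⁿ/n!.
  egfCoeff : Series → ℕ → Carrier
  egfCoeff f n = fromℕ (n !) * f n

  S₂ : ℕ → ℕ → Carrier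
  S₂ n k = egfCoeff (invFact k ∙ₛ (expₛ 1# -ₛ 1ₛ) ^ₛ k) n

  -- The coefficient of x^N in Li_{k₁,…,kₛ}(x), i.e. the sum of
  -- n₁^{-k₁} ⋯ nₛ^{-kₛ} over 0 < n₁ < ⋯ < nₛ = N, with the convention Li_∅ = 1.
  -- The inner sum runs over the value of nₛ₋₁.
  Li : ∀ s → Vector ℤ s → Series
  Li zero    k N       = 1ₛ N
  Li (suc s) k zero    = 0#
  Li (suc s) k (suc N) = suc N ^ℤ (ℤ.- last k) * ∑< (suc N) (Li s (init k))

  1-e⁻ᵗ : Series
  1-e⁻ᵗ = 1ₛ -ₛ expₛ (- 1#)

  module _ (lam : Carrier) (lam#0 : lam # 0#) where

    -- (1 + λt)^{x/λ}, by the binomial series.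
    degExp : Carrier → Series
    degExp x n = binom (x * recip lam lam#0) n * lam ^ n

    degExp-1 : Series
    degExp-1 = degExp 1# -ₛ 1ₛ

    degBernoulli : ℕ → Carrier
    degBernoulli = egfCoeff (quotient tₛ degExp-1 1)

    multiPolyNumerator : ∀ s → Vector ℤ s → Carrier → Series
    multiPolyNumerator s k x = (fromℕ (s !) ∙ₛ compose (Li s k) 1-e⁻ᵗ) *ₛ degExp x

    -- The value at x of the degenerate multi-poly-Bernoulli polynomial.
    degMultiPolyBernoulli : ∀ s → Vector ℤ s → ℕ → Carrier → Carrier
    degMultiPolyBernoulli s k n x = egfCoeff (quotient (multiPolyNumerator s k x) degExp-1 s) n

  infix 4 _ConvergesTo_ _SumsTo_

  _ConvergesTo_ : (ℕ → Carrier) → Carrier → Set (c ⊔ ℓ₂)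
  a ConvergesTo S = (λ N → ∑< N a) ⟶ S

  polynomial : List Carrier → Series
  polynomial []       n       = 0#
  polynomial (p ∷ ps) zero    = p
  polynomial (p ∷ ps) (suc n) = polynomial ps n

  polynomialAt1 : List Carrier → Carrier
  polynomialAt1 = foldr _+_ 0#

  -- Euler's sum of a possibly divergent series: Σ aₘ zᵐ is the expansion of a
  -- rational function P/Q with Q(1) ≠ 0, and S = P(1)/Q(1). The sum is unique
  -- (`SumsTo-unique`) and agrees with the ordinary one if Σ aₘ also converges
  -- (`SumsTo-regular`). For example 1 - 1 + 1 - ⋯ sums to 1/2, and
  -- Σₘ binom(-k,m) yᵐ sums to (1 + y)⁻ᵏ for all k ∈ ℤ and y > 0, whereas
  -- it does not converge when k ≥ 1 and y ≥ 1.
  _SumsTo_ : (ℕ → Carrier) → Carrier → Set (c ⊔ ℓ₁ ⊔ ℓ₂)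
  a SumsTo S = ∃ λ P → ∃ λ Q → (polynomial Q *ₛ a ≋ polynomial P) ×
                 (polynomialAt1 Q # 0#) × (S * polynomialAt1 Q ≈ polynomialAt1 P)

  open SetoidReasoning setoid
  open CSProperties +-commutativeSemigroup using () renaming (interchange to +-interchange; x∙yz≈y∙xz to +-swapˡ)
  open CSProperties *-commutativeSemigroup using () renaming (x∙yz≈y∙xz to *-swapˡ)

  private
    infixl 6 _+ₛ_

    _+ₛ_ : Series → Series → Series
    (f +ₛ g) n = f n + g n

    tail : Series → Series
    tail f n = f (suc n)

    ∑-cong< : ∀ n {f g} → (∀ i → i ℕ.< n → f i ≈ g i) → ∑< n f ≈ ∑< n g
    ∑-cong< zero    f≈g = refl
    ∑-cong< (suc n) f≈g = +-cong (f≈g 0 (s≤s z≤n)) (∑-cong< n λ i i<n → f≈g (suc i) (s≤s i<n))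

    ∑-cong : ∀ n {f g} → (∀ i → f i ≈ g i) → ∑< n f ≈ ∑< n g
    ∑-cong n f≈g = ∑-cong< n λ i _ → f≈g i

    ∑-zero : ∀ n {f} → (∀ i → i ℕ.< n → f i ≈ 0#) → ∑< n f ≈ 0#
    ∑-zero zero    f≈0 = refl
    ∑-zero (suc n) f≈0 = trans (+-cong (f≈0 0 (s≤s z≤n)) (∑-zero n λ i i<n → f≈0 (suc i) (s≤s i<n))) (+-identityˡ 0#)

    ∑-+ : ∀ n f g → ∑< n (λ i → f i + g i) ≈ ∑< n f + ∑< n g
    ∑-+ zero    f g = sym (+-identityˡ 0#)
    ∑-+ (suc n) f g = trans (+-congˡ (∑-+ n (tail f) (tail g))) (+-interchange _ _ _ _)

    ∑-*ˡ : ∀ n a f → ∑< n (λ i → a * f i) ≈ a * ∑< n f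
    ∑-*ˡ zero    a f = sym (zeroʳ a)
    ∑-*ˡ (suc n) a f = trans (+-congˡ (∑-*ˡ n a (tail f))) (sym (distribˡ a _ _))

    ∑-last : ∀ n f → ∑< (suc n) f ≈ ∑< n f + f n
    ∑-last zero    f = trans (+-identityʳ _) (sym (+-identityˡ _))
    ∑-last (suc n) f = trans (+-congˡ (∑-last n (tail f))) (sym (+-assoc _ _ _))

    *ₛ-cong≤ : ∀ n {f f′ g g′} → (∀ i → i ℕ.≤ n → f i ≈ f′ i) → (∀ i → i ℕ.≤ n → g i ≈ g′ i) →
               (f *ₛ g) n ≈ (f′ *ₛ g′) n
    *ₛ-cong≤ n f≈ g≈ = ∑-cong< (suc n) λ i i<1+n → *-cong (f≈ i (ℕₚ.≤-pred i<1+n)) (g≈ _ (ℕₚ.m∸n≤m n i))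

    *ₛ-cong : ∀ {f f′ g g′} → f ≋ f′ → g ≋ g′ → f *ₛ g ≋ f′ *ₛ g′
    *ₛ-cong f≈ g≈ n = *ₛ-cong≤ n (λ i _ → f≈ i) (λ i _ → g≈ i)

    *ₛ-zeroʳ : ∀ n {f g} → (∀ i → i ℕ.≤ n → g i ≈ 0#) → (f *ₛ g) n ≈ 0#
    *ₛ-zeroʳ n {f} g≈0 = ∑-zero (suc n) λ i _ → trans (*-congˡ (g≈0 _ (ℕₚ.m∸n≤m n i))) (zeroʳ (f i))

    *ₛ-distribʳ : ∀ f g h → (f +ₛ g) *ₛ h ≋ (f *ₛ h) +ₛ (g *ₛ h)
    *ₛ-distribʳ f g h n = trans (∑-cong (suc n) λ i → distribʳ (h (n ℕ.∸ i)) (f i) (g i)) (∑-+ (suc n) (λ i → f i * h (n ℕ.∸ i)) (λ i → g i * h (n ℕ.∸ i)))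

    *ₛ-scaleˡ : ∀ a f g → (a ∙ₛ f) *ₛ g ≋ a ∙ₛ (f *ₛ g)
    *ₛ-scaleˡ a f g n = trans (∑-cong (suc n) λ i → *-assoc a (f i) (g (n ℕ.∸ i))) (∑-*ˡ (suc n) a λ i → f i * g (n ℕ.∸ i))

    *ₛ-assoc : ∀ f g h → (f *ₛ g) *ₛ h ≋ f *ₛ (g *ₛ h)
    *ₛ-assoc f g h zero = +-congʳ (begin
      (f 0 * g 0 + 0#) * h 0 ≈⟨ *-congʳ (+-identityʳ _) ⟩
      f 0 * g 0 * h 0        ≈⟨ *-assoc _ _ _ ⟩
      f 0 * (g 0 * h 0)      ≈⟨ *-congˡ (+-identityʳ _) ⟨
      f 0 * (g 0 * h 0 + 0#) ∎)
    *ₛ-assoc f g h (suc n) = begin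
      (f 0 * g 0 + 0#) * h (suc n) + ((f 0 ∙ₛ tail g +ₛ tail f *ₛ g) *ₛ h) n
        ≈⟨ +-cong (trans (*-congʳ (+-identityʳ _)) (*-assoc _ _ _))
             (trans (*ₛ-distribʳ (f 0 ∙ₛ tail g) (tail f *ₛ g) h n) (+-cong (*ₛ-scaleˡ (f 0) (tail g) h n) (*ₛ-assoc (tail f) g h n))) ⟩
      f 0 * (g 0 * h (suc n)) + (f 0 * (tail g *ₛ h) n + (tail f *ₛ (g *ₛ h)) n)
        ≈⟨ +-assoc _ _ _ ⟨
      f 0 * (g 0 * h (suc n)) + f 0 * (tail g *ₛ h) n + (tail f *ₛ (g *ₛ h)) n
        ≈⟨ +-congʳ (distribˡ _ _ _) ⟨
      f 0 * (g 0 * h (suc n) + (tail g *ₛ h) n) + (tail f *ₛ (g *ₛ h)) n ∎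

    *ₛ-sucʳ : ∀ f g n → (f *ₛ g) (suc n) ≈ (f *ₛ tail g) n + f (suc n) * g 0
    *ₛ-sucʳ f g zero    = trans (+-congˡ (+-identityʳ _)) (+-congʳ (sym (+-identityʳ _)))
    *ₛ-sucʳ f g (suc n) = trans (+-congˡ (*ₛ-sucʳ (tail f) g n)) (sym (+-assoc _ _ _))

    *ₛ-comm : ∀ f g → f *ₛ g ≋ g *ₛ f
    *ₛ-comm f g zero    = +-congʳ (*-comm _ _)
    *ₛ-comm f g (suc n) = begin
      (f *ₛ g) (suc n)                  ≈⟨ *ₛ-sucʳ f g n ⟩
      (f *ₛ tail g) n + f (suc n) * g 0 ≈⟨ +-cong (*ₛ-comm f (tail g) n) (*-comm _ _) ⟩
      (tail g *ₛ f) n + g 0 * f (suc n) ≈⟨ +-comm _ _ ⟩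
      (g *ₛ f) (suc n)                  ∎

    *ₛ-identityˡ : ∀ f → 1ₛ *ₛ f ≋ f
    *ₛ-identityˡ f zero    = trans (+-identityʳ _) (*-identityˡ _)
    *ₛ-identityˡ f (suc n) = trans (+-cong (*-identityˡ _) (∑-zero (suc n) λ i _ → zeroˡ (f (n ℕ.∸ i)))) (+-identityʳ _)

    *ₛ-∑ : ∀ M f (g : ℕ → Series) → f *ₛ (λ n → ∑< M (λ j → g j n)) ≋ λ n → ∑< M (λ j → (f *ₛ g j) n)
    *ₛ-∑ zero    f g n = *ₛ-zeroʳ n {f} {λ _ → 0#} λ _ _ → refl
    *ₛ-∑ (suc M) f g n = begin
      (f *ₛ (g 0 +ₛ G)) n          ≈⟨ *ₛ-comm f (g 0 +ₛ G) n ⟩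
      ((g 0 +ₛ G) *ₛ f) n          ≈⟨ *ₛ-distribʳ (g 0) G f n ⟩
      (g 0 *ₛ f) n + (G *ₛ f) n    ≈⟨ +-cong (*ₛ-comm (g 0) f n) (*ₛ-comm G f n) ⟩
      (f *ₛ g 0) n + (f *ₛ G) n    ≈⟨ +-congˡ (*ₛ-∑ M f (λ j → g (suc j)) n) ⟩
      (f *ₛ g 0) n + ∑< M (λ j → (f *ₛ g (suc j)) n) ∎
      where
      G : Series
      G n = ∑< M λ j → g (suc j) n

    t*ₛ : ∀ {d} f → d 0 ≈ 0# → ∀ n → (d *ₛ f) (suc n) ≈ (tail d *ₛ f) n
    t*ₛ f d₀≈0 n = trans (+-congʳ (trans (*-congʳ d₀≈0) (zeroˡ _))) (+-identityˡ _)

    ^ₛ-order : ∀ {v} → v 0 ≈ 0# → ∀ j n → n ℕ.< j → (v ^ₛ j) n ≈ 0#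
    ^ₛ-order v₀≈0 (suc j) zero    n<j = trans (+-identityʳ _) (trans (*-congʳ v₀≈0) (zeroˡ _))
    ^ₛ-order {v} v₀≈0 (suc j) (suc n) (s≤s n<j) =
      trans (t*ₛ {v} (v ^ₛ j) v₀≈0 n) (*ₛ-zeroʳ n {tail v} λ i i≤n → ^ₛ-order v₀≈0 j i (ℕₚ.≤-<-trans i≤n n<j))

    ∑-extend : ∀ {n M} f → n ℕ.≤ M → (∀ j → n ℕ.≤ j → f j ≈ 0#) → ∑< n f ≈ ∑< M f
    ∑-extend {M = M} f z≤n f≈0 = sym (∑-zero M λ i _ → f≈0 i z≤n)
    ∑-extend f (s≤s n≤M) f≈0   = +-congˡ (∑-extend (tail f) n≤M λ j n≤j → f≈0 (suc j) (s≤s n≤j))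

    geometric : ∀ {v} → v 0 ≈ 0# → compose (λ _ → 1#) v ≋ 1ₛ +ₛ v *ₛ compose (λ _ → 1#) v
    geometric {v} v₀≈0 n = begin
      W n                                          ≈⟨ W≈ n (suc n) (ℕₚ.n≤1+n n) ⟩
      1ₛ n + ∑< (suc n) (λ j → (v *ₛ v ^ₛ j) n)    ≈⟨ +-congˡ (*ₛ-∑ (suc n) v (v ^ₛ_) n) ⟨
      1ₛ n + (v *ₛ (λ m → ∑< (suc n) (λ j → (v ^ₛ j) m))) n
        ≈⟨ +-congˡ (*ₛ-cong≤ n {v} (λ _ _ → refl) (λ i i≤n → W≈ i n i≤n)) ⟨
      1ₛ n + (v *ₛ W) n ∎
      where
      W : Series
      W = compose (λ _ → 1#) v
      W≈ : ∀ m M → m ℕ.≤ M → W m ≈ ∑< (suc M) (λ j → (v ^ₛ j) m)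
      W≈ m M m≤M = trans (∑-cong (suc m) λ j → *-identityˡ ((v ^ₛ j) m))
        (∑-extend (λ j → (v ^ₛ j) m) (s≤s m≤M) λ j m<j → ^ₛ-order v₀≈0 j m m<j)

    +-cancelʳ : ∀ {x y} z → x + z ≈ y + z → x ≈ y
    +-cancelʳ {x} {y} z eq = begin
      x             ≈⟨ +-identityʳ x ⟨
      x + 0#        ≈⟨ +-congˡ (-‿inverseʳ z) ⟨
      x + (z - z)   ≈⟨ +-assoc _ _ _ ⟨
      (x + z) - z   ≈⟨ +-congʳ eq ⟩
      (y + z) - z   ≈⟨ +-assoc _ _ _ ⟩
      y + (z - z)   ≈⟨ +-congˡ (-‿inverseʳ z) ⟩
      y + 0#        ≈⟨ +-identityʳ y ⟩
      y             ∎

  inverseₛ-spec : ∀ g → g 0 ≈ 1# → g *ₛ inverseₛ g ≋ 1ₛ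
  inverseₛ-spec g g₀≈1 n = +-cancelʳ ((v *ₛ W) n) (begin
    (g *ₛ W) n + (v *ₛ W) n ≈⟨ *ₛ-distribʳ g v W n ⟨
    ((g +ₛ v) *ₛ W) n       ≈⟨ *ₛ-cong {g = W} g+v≈1 (λ _ → refl) n ⟩
    (1ₛ *ₛ W) n             ≈⟨ *ₛ-identityˡ W n ⟩
    W n                     ≈⟨ geometric v₀≈0 n ⟩
    1ₛ n + (v *ₛ W) n       ∎)
    where
    v W : Series
    v = 1ₛ -ₛ g
    W = inverseₛ g
    v₀≈0 : v 0 ≈ 0#
    v₀≈0 = trans (+-congˡ (-‿cong g₀≈1)) (-‿inverseʳ 1#)
    g+v≈1 : g +ₛ v ≋ 1ₛ
    g+v≈1 m = trans (+-swapˡ (g m) (1ₛ m) _) (trans (+-congˡ (-‿inverseʳ (g m))) (+-identityʳ _))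

  quotient-spec : ∀ f d s → d 0 ≈ 0# → d 1 ≈ 1# → (∀ i → i ℕ.< s → f i ≈ 0#) →
                  d ^ₛ s *ₛ quotient f d s ≋ f
  quotient-spec f d zero    d₀ d₁ f₀ n = trans (*ₛ-identityˡ (f *ₛ 1ₛ) n) (trans (*ₛ-comm f 1ₛ n) (*ₛ-identityˡ f n))
  quotient-spec f d (suc s) d₀ d₁ f₀ n = begin
    ((d *ₛ d ^ₛ s) *ₛ (shift (suc s) f *ₛ (h *ₛ h ^ₛ s))) n
      ≈⟨ *ₛ-cong {g = shift (suc s) f *ₛ (h *ₛ h ^ₛ s)} (*ₛ-comm d (d ^ₛ s))
           (λ m → sym (*ₛ-assoc (shift (suc s) f) h (h ^ₛ s) m)) n ⟩
    ((d ^ₛ s *ₛ d) *ₛ ((shift (suc s) f *ₛ h) *ₛ h ^ₛ s)) n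
      ≈⟨ *ₛ-assoc (d ^ₛ s) d ((shift (suc s) f *ₛ h) *ₛ h ^ₛ s) n ⟩
    (d ^ₛ s *ₛ (d *ₛ ((shift (suc s) f *ₛ h) *ₛ h ^ₛ s))) n
      ≈⟨ *ₛ-cong {d ^ₛ s} (λ _ → refl) (λ m → trans (sym (*ₛ-assoc d (shift (suc s) f *ₛ h) (h ^ₛ s) m))
           (*ₛ-cong {g = h ^ₛ s} step (λ _ → refl) m)) n ⟩
    (d ^ₛ s *ₛ (shift s f *ₛ h ^ₛ s)) n
      ≈⟨ quotient-spec f d s d₀ d₁ (λ i i<s → f₀ i (ℕₚ.m<n⇒m<1+n i<s)) n ⟩
    f n ∎
    where
    h : Series
    h = inverseₛ (shift 1 d)
    step : d *ₛ (shift (suc s) f *ₛ h) ≋ shift s f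
    step zero    = begin
      d 0 * _ + 0# ≈⟨ trans (+-identityʳ _) (trans (*-congʳ d₀) (zeroˡ _)) ⟩
      0#           ≈⟨ f₀ s (ℕₚ.n<1+n s) ⟨
      f s          ≡⟨ ≡.cong f (ℕₚ.+-identityʳ s) ⟨
      f (s ℕ.+ 0)  ∎
    step (suc m) = begin
      (d *ₛ (shift (suc s) f *ₛ h)) (suc m) ≈⟨ t*ₛ {d} (shift (suc s) f *ₛ h) d₀ m ⟩
      (tail d *ₛ (shift (suc s) f *ₛ h)) m  ≈⟨ *ₛ-cong {tail d} (λ _ → refl) (*ₛ-comm (shift (suc s) f) h) m ⟩
      (tail d *ₛ (h *ₛ shift (suc s) f)) m  ≈⟨ *ₛ-assoc (tail d) h (shift (suc s) f) m ⟨
      ((tail d *ₛ h) *ₛ shift (suc s) f) m  ≈⟨ *ₛ-cong {g = shift (suc s) f} (inverseₛ-spec (shift 1 d) d₁) (λ _ → refl) m ⟩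
      (1ₛ *ₛ shift (suc s) f) m             ≈⟨ *ₛ-identityˡ (shift (suc s) f) m ⟩
      f (suc s ℕ.+ m)                       ≡⟨ ≡.cong f (ℕₚ.+-suc s m) ⟨
      f (s ℕ.+ suc m)                       ∎

  egf-spec : ∀ f → egf (egfCoeff f) ≋ f
  egf-spec f n = begin
    fromℕ (n !) * f n * invFact n   ≈⟨ *-congʳ (*-comm _ _) ⟩
    f n * fromℕ (n !) * invFact n   ≈⟨ *-assoc _ _ _ ⟩
    f n * (fromℕ (n !) * invFact n) ≈⟨ *-congˡ (recip-inverse _ _) ⟩
    f n * 1#                        ≈⟨ *-identityʳ _ ⟩
    f n                             ∎

  S₂-gf : ∀ k → invFact k ∙ₛ (expₛ 1# -ₛ 1ₛ) ^ₛ k ≋ egf (λ n → S₂ n k)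
  S₂-gf k n = sym (egf-spec (invFact k ∙ₛ (expₛ 1# -ₛ 1ₛ) ^ₛ k) n)

  private
    Li-order : ∀ s k N → N ℕ.< s → Li s k N ≈ 0#
    Li-order (suc s) k zero    _         = refl
    Li-order (suc s) k (suc N) (s≤s N<s) =
      trans (*-congˡ (∑-zero (suc N) λ i i<1+N → Li-order s (init k) i (ℕₚ.<-≤-trans i<1+N N<s))) (zeroʳ _)

    n!≡1⇒invFact≈1 : ∀ n → n ! ≡ 1 → invFact n ≈ 1#
    n!≡1⇒invFact≈1 n n!≡1 = begin
      invFact n                 ≈⟨ *-identityˡ _ ⟨
      1# * invFact n            ≈⟨ *-congʳ (+-identityʳ 1#) ⟨
      fromℕ 1 * invFact n       ≡⟨ ≡.cong (λ m → fromℕ m * invFact n) n!≡1 ⟨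
      fromℕ (n !) * invFact n   ≈⟨ recip-inverse _ _ ⟩
      1#                        ∎

  module _ (lam : Carrier) (lam#0 : lam # 0#) where
    private
      d : Series
      d = degExp-1 lam lam#0

      d₀ : d 0 ≈ 0#
      d₀ = begin
        1# * invFact 0 * 1# - 1# ≈⟨ +-congʳ (trans (*-identityʳ _) (*-identityˡ _)) ⟩
        invFact 0 - 1#           ≈⟨ +-congʳ (n!≡1⇒invFact≈1 0 ≡.refl) ⟩
        1# - 1#                  ≈⟨ -‿inverseʳ 1# ⟩
        0#                       ∎

      d₁ : d 1 ≈ 1#
      d₁ = begin
        (1# * λ⁻¹) * 1# * invFact 1 * (lam * 1#) - 0#
          ≈⟨ +-cong (*-cong (*-cong (trans (*-identityʳ _) (*-identityˡ _)) (n!≡1⇒invFact≈1 1 ≡.refl)) (*-identityʳ _)) -0#≈0# ⟩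
        λ⁻¹ * 1# * lam + 0# ≈⟨ +-identityʳ _ ⟩
        λ⁻¹ * 1# * lam      ≈⟨ *-congʳ (*-identityʳ _) ⟩
        λ⁻¹ * lam           ≈⟨ *-comm _ _ ⟩
        lam * λ⁻¹           ≈⟨ recip-inverse _ _ ⟩
        1#                  ∎
        where
        λ⁻¹ : Carrier
        λ⁻¹ = recip lam lam#0

    degBernoulli-gf : degExp-1 lam lam#0 *ₛ egf (degBernoulli lam lam#0) ≋ tₛ
    degBernoulli-gf n = begin
      (d *ₛ egf (degBernoulli lam lam#0)) n
        ≈⟨ *ₛ-cong {d} (λ m → sym (trans (*ₛ-comm d 1ₛ m) (*ₛ-identityˡ d m))) (egf-spec (quotient tₛ d 1)) n ⟩
      (d ^ₛ 1 *ₛ quotient tₛ d 1) n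
        ≈⟨ quotient-spec tₛ d 1 d₀ d₁ (λ { zero _ → refl ; (suc _) (s≤s ()) }) n ⟩
      tₛ n ∎

    degMultiPolyBernoulli-gf : ∀ s k x →
      degExp-1 lam lam#0 ^ₛ s *ₛ egf (λ n → degMultiPolyBernoulli lam lam#0 s k n x) ≋
      (fromℕ (s !) ∙ₛ compose (Li s k) 1-e⁻ᵗ) *ₛ degExp lam lam#0 x
    degMultiPolyBernoulli-gf s k x n = trans
      (*ₛ-cong {d ^ₛ s} (λ _ → refl) (egf-spec (quotient A d s)) n)
      (quotient-spec A d s d₀ d₁ A-order n)
      where
      A B : Series
      A = multiPolyNumerator lam lam#0 s k x
      B = fromℕ (s !) ∙ₛ compose (Li s k) 1-e⁻ᵗ
      A-order : ∀ i → i ℕ.< s → A i ≈ 0#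
      A-order i i<s = trans (*ₛ-comm B (degExp lam lam#0 x) i) (*ₛ-zeroʳ i {degExp lam lam#0 x} {B} λ j j≤i →
        trans (*-congˡ (∑-zero (suc j) λ N N≤j →
          trans (*-congʳ (Li-order s k N (ℕₚ.<-≤-trans N≤j (ℕₚ.≤-<-trans j≤i i<s)))) (zeroˡ ((1-e⁻ᵗ ^ₛ N) j)))) (zeroʳ (fromℕ (s !))))

  private
    <⇒0<- : ∀ {x y} → x < y → 0# < y - x
    <⇒0<- {x} {y} x<y = <-respˡ-≈ (-‿inverseˡ x) (<-respʳ-≈ (+-comm _ _) (+-monoˡ-< (- x) x<y))

    +-cancel-neg : ∀ x y → x + (y - x) ≈ y
    +-cancel-neg x y = trans (+-swapˡ x y (- x)) (trans (+-congˡ (-‿inverseʳ x)) (+-identityʳ y))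

    *-monoˡ-< : ∀ {c x y} → 0# < c → x < y → c * x < c * y
    *-monoˡ-< {c} {x} {y} 0<c x<y = <-respˡ-≈ (+-identityʳ _)
      (<-respʳ-≈ (trans (sym (distribˡ c x (y - x))) (*-congˡ (+-cancel-neg x y)))
        (+-monoˡ-< (c * x) (*-pos 0<c (<⇒0<- x<y))))

    +-mono-< : ∀ {x y u v} → x < y → u < v → x + u < y + v
    +-mono-< {x} {y} {u} {v} x<y u<v = <-trans (+-monoˡ-< x u<v)
      (<-respˡ-≈ (+-comm _ _) (<-respʳ-≈ (+-comm _ _) (+-monoˡ-< v x<y)))

    0<·⇒0< : ∀ n {x} → 0# < n · x → 0# < x
    0<·⇒0< zero    0<0 = ⊥-elim (<-irrefl refl 0<0)
    0<·⇒0< (suc n) {x} 0<x+nx with <-cotrans 0<x+nx x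
    ... | inj₁ 0<x    = 0<x
    ... | inj₂ x<x+nx = 0<·⇒0< n (<-respʳ-≈ (trans (+-congʳ (+-comm x _)) (trans (+-assoc _ _ _)
                          (trans (+-congˡ (-‿inverseʳ x)) (+-identityʳ _)))) (<⇒0<- x<x+nx))

    ·≈* : ∀ n x → n · x ≈ fromℕ n * x
    ·≈* zero    x = sym (zeroˡ x)
    ·≈* (suc n) x = trans (+-cong (sym (*-identityˡ x)) (·≈* n x)) (sym (distribʳ x 1# _))

    0<1/ : ∀ n → 0# < 1/ suc n
    0<1/ n = 0<·⇒0< (suc n) (<-respʳ-≈ (sym (trans (·≈* (suc n) _) (recip-inverse _ _))) 0<1)

    n*ε/n : ∀ n ε → fromℕ (suc n) * (ε * 1/ suc n) ≈ ε
    n*ε/n n ε = trans (*-swapˡ _ ε _) (trans (*-congˡ (recip-inverse _ _)) (*-identityʳ ε))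

    n<1+n : ∀ n → fromℕ n < fromℕ (suc n)
    n<1+n n = <-respˡ-≈ (+-identityʳ _) (<-respʳ-≈ (+-comm _ _) (+-monoˡ-< (fromℕ n) 0<1))

    lim-cong : ∀ {f g L M} → (∀ n → f n ≈ g n) → L ≈ M → f ⟶ L → g ⟶ M
    lim-cong f≈g L≈M lim ε 0<ε with lim ε 0<ε
    ... | N , near = N , λ n N≤n →
      <-respˡ-≈ (f≈g n) (<-respʳ-≈ (+-congʳ L≈M) (proj₁ (near n N≤n))) ,
      <-respˡ-≈ L≈M (<-respʳ-≈ (+-congʳ (f≈g n)) (proj₂ (near n N≤n)))

    lim-const : ∀ {f L} → (∀ n → f n ≈ L) → f ⟶ L
    lim-const {f} {L} f≈L ε 0<ε = 0 , λ n _ → <-respˡ-≈ (sym (f≈L n)) L<L+ε , <-respʳ-≈ (+-congʳ (sym (f≈L n))) L<L+ε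
      where
      L<L+ε : L < L + ε
      L<L+ε = <-respˡ-≈ (+-identityʳ L) (+-monoˡ-< L 0<ε)

    lim-suc : ∀ {f L} → f ⟶ L → (λ n → f (suc n)) ⟶ L
    lim-suc lim ε 0<ε with lim ε 0<ε
    ... | N , near = N , λ n N≤n → near (suc n) (ℕₚ.m≤n⇒m≤1+n N≤n)

    lim-unsuc : ∀ {f L} → (λ n → f (suc n)) ⟶ L → f ⟶ L
    lim-unsuc lim ε 0<ε with lim ε 0<ε
    ... | N , near = suc N , λ { (suc n) (s≤s N≤n) → near n N≤n }

    ε/2+ε/2 : ∀ ε → ε * 1/ 2 + ε * 1/ 2 ≈ ε
    ε/2+ε/2 ε = trans (+-congˡ (sym (+-identityʳ _))) (trans (·≈* 2 _) (n*ε/n 1 ε))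

    lim-+ : ∀ {f g L M} → f ⟶ L → g ⟶ M → (λ n → f n + g n) ⟶ (L + M)
    lim-+ {f} {g} {L} {M} limf limg ε 0<ε with limf (ε * 1/ 2) (*-pos 0<ε (0<1/ 1)) | limg (ε * 1/ 2) (*-pos 0<ε (0<1/ 1))
    ... | N , nearf | N′ , nearg = N ℕ.⊔ N′ , λ n N≤n →
      let (f<L , L<f) = nearf n (ℕₚ.m⊔n≤o⇒m≤o N N′ N≤n)
          (g<M , M<g) = nearg n (ℕₚ.m⊔n≤o⇒n≤o N N′ N≤n)
      in <-respʳ-≈ (collect L M) (+-mono-< f<L g<M) , <-respʳ-≈ (collect (f n) (g n)) (+-mono-< L<f M<g)
      where
      collect : ∀ a b → (a + ε * 1/ 2) + (b + ε * 1/ 2) ≈ (a + b) + ε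
      collect a b = trans (+-interchange _ _ _ _) (+-congˡ (ε/2+ε/2 ε))

    flip-< : ∀ {a b ε} → a < b + ε → - b < - a + ε
    flip-< {a} {b} {ε} a<b+ε = <-respˡ-≈ (trans (+-assoc _ _ _) (trans (+-congˡ (-‿inverseˡ a)) (+-identityʳ _)))
      (<-respʳ-≈ (trans (+-congʳ (+-comm (- b) (- a))) (trans (+-assoc _ _ _) (+-congˡ (trans (sym (+-assoc _ _ _))
        (trans (+-congʳ (-‿inverseˡ b)) (+-identityˡ ε))))))
        (+-monoˡ-< (- b - a) a<b+ε))

    lim-neg : ∀ {f L} → f ⟶ L → (λ n → - f n) ⟶ (- L)
    lim-neg lim ε 0<ε with lim ε 0<ε
    ... | N , near = N , λ n N≤n → flip-< (proj₂ (near n N≤n)) , flip-< (proj₁ (near n N≤n))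

    lim-pos* : ∀ {q f L} → 0# < q → f ⟶ L → (λ n → q * f n) ⟶ (q * L)
    lim-pos* {q} {f} {L} 0<q lim ε 0<ε with archimedean q
    ... | m , q<m with lim (ε * 1/ suc m) (*-pos 0<ε (0<1/ m))
    ... | N , near = N , λ n N≤n → scale (proj₁ (near n N≤n)) , scale (proj₂ (near n N≤n))
      where
      qδ<ε : q * (ε * 1/ suc m) < ε
      qδ<ε = <-respˡ-≈ (*-comm _ _) (<-respʳ-≈ (trans (*-comm _ _) (n*ε/n m ε))
               (*-monoˡ-< (*-pos 0<ε (0<1/ m)) (<-trans q<m (n<1+n m))))
      scale : ∀ {a b} → a < b + ε * 1/ suc m → q * a < q * b + ε
      scale {a} {b} a<b = <-trans (<-respʳ-≈ (distribˡ q b _) (*-monoˡ-< 0<q a<b)) (+-monoˡ-< (q * b) qδ<ε)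

    lim-* : ∀ q {f L} → f ⟶ L → (λ n → q * f n) ⟶ (q * L)
    lim-* q {f} {L} lim with archimedean (- q)
    ... | m , -q<m = lim-cong (λ n → split (f n)) (split L) (lim-+ (lim-pos* 0<q+M lim) (lim-neg (lim-pos* (0<1+n m) lim)))
      where
      M : Carrier
      M = fromℕ (suc m)
      0<q+M : 0# < q + M
      0<q+M = <-respˡ-≈ (-‿inverseʳ q) (+-monoˡ-< q (<-trans -q<m (n<1+n m)))
      split : ∀ y → (q + M) * y + - (M * y) ≈ q * y
      split y = trans (+-congʳ (distribʳ y q M)) (trans (+-assoc _ _ _) (trans (+-congˡ (-‿inverseʳ (M * y))) (+-identityʳ _)))

    lim-≮ : ∀ {f L M} → f ⟶ L → f ⟶ M → ¬ (L < M)
    lim-≮ {f} {L} {M} limL limM L<M with limL ((M - L) * 1/ 2) (*-pos (<⇒0<- L<M) (0<1/ 1)) | limM ((M - L) * 1/ 2) (*-pos (<⇒0<- L<M) (0<1/ 1))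
    ... | N , nearL | N′ , nearM = <-irrefl eq (+-mono-< (proj₂ (nearM n (ℕₚ.m≤n⊔m N N′))) (proj₁ (nearL n (ℕₚ.m≤m⊔n N N′))))
      where
      n : ℕ
      n = N ℕ.⊔ N′
      δ : Carrier
      δ = (M - L) * 1/ 2
      eq : M + f n ≈ (f n + δ) + (L + δ)
      eq = sym (begin
        (f n + δ) + (L + δ) ≈⟨ +-interchange _ _ _ _ ⟩
        (f n + L) + (δ + δ) ≈⟨ +-congˡ (ε/2+ε/2 (M - L)) ⟩
        (f n + L) + (M - L) ≈⟨ +-assoc _ _ _ ⟩
        f n + (L + (M - L)) ≈⟨ +-congˡ (+-cancel-neg L M) ⟩
        f n + M             ≈⟨ +-comm _ _ ⟩
        M + f n             ∎)

    lim-unique : ∀ {f L M} → f ⟶ L → f ⟶ M → L ≈ M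
    lim-unique limL limM = tight λ { (inj₁ L<M) → lim-≮ limL limM L<M ; (inj₂ M<L) → lim-≮ limM limL M<L }

    polynomial-ConvergesTo : ∀ P → polynomial P ConvergesTo polynomialAt1 P
    polynomial-ConvergesTo []      = lim-const λ N → ∑-zero N λ _ _ → refl
    polynomial-ConvergesTo (p ∷ P) = lim-unsuc (lim-+ (lim-const λ _ → refl) (polynomial-ConvergesTo P))

    polynomial*-ConvergesTo : ∀ Q {b B} → b ConvergesTo B → (polynomial Q *ₛ b) ConvergesTo (polynomialAt1 Q * B)
    polynomial*-ConvergesTo [] {b} {B} lim = lim-const λ N →
      trans (∑-zero N λ i _ → ∑-zero (suc i) λ j _ → zeroˡ (b (i ℕ.∸ j))) (sym (zeroˡ B))
    polynomial*-ConvergesTo (q ∷ Q) {b} {B} lim = lim-unsuc (lim-cong partial (sym (distribʳ B q _))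
      (lim-+ (lim-* q (lim-suc lim)) (polynomial*-ConvergesTo Q lim)))
      where
      partial : ∀ N → q * ∑< (suc N) b + ∑< N (polynomial Q *ₛ b) ≈ ∑< (suc N) (polynomial (q ∷ Q) *ₛ b)
      partial N = sym (begin
        (q * b 0 + 0#) + ∑< N (λ i → q * b (suc i) + (polynomial Q *ₛ b) i)
          ≈⟨ +-cong (+-identityʳ _) (∑-+ N _ _) ⟩
        q * b 0 + (∑< N (λ i → q * b (suc i)) + ∑< N (polynomial Q *ₛ b))
          ≈⟨ +-assoc _ _ _ ⟨
        (q * b 0 + ∑< N (λ i → q * b (suc i))) + ∑< N (polynomial Q *ₛ b)
          ≈⟨ +-congʳ (∑-*ˡ (suc N) q b) ⟩
        q * ∑< (suc N) b + ∑< N (polynomial Q *ₛ b) ∎)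

    ConvergesTo-unique : ∀ {a b S T} → a ≋ b → a ConvergesTo S → b ConvergesTo T → S ≈ T
    ConvergesTo-unique a≋b limS limT = lim-unique (lim-cong (λ N → ∑-cong N a≋b) refl limS) limT

    *-cancelʳ-# : ∀ {x y z} → z # 0# → x * z ≈ y * z → x ≈ y
    *-cancelʳ-# {x} {y} {z} z#0 eq = begin
      x                      ≈⟨ *-identityʳ x ⟨
      x * 1#                 ≈⟨ *-congˡ (recip-inverse z z#0) ⟨
      x * (z * recip z z#0)  ≈⟨ *-assoc _ _ _ ⟨
      x * z * recip z z#0    ≈⟨ *-congʳ eq ⟩
      y * z * recip z z#0    ≈⟨ *-assoc _ _ _ ⟩
      y * (z * recip z z#0)  ≈⟨ *-congˡ (recip-inverse z z#0) ⟩
      y * 1#                 ≈⟨ *-identityʳ y ⟩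
      y                      ∎

  SumsTo-regular : ∀ {a S T} → a SumsTo S → a ConvergesTo T → S ≈ T
  SumsTo-regular {a} {S} {T} (P , Q , Qa≋P , Q#0 , SQ≈P) lim = *-cancelʳ-# Q#0 (begin
    S * polynomialAt1 Q ≈⟨ SQ≈P ⟩
    polynomialAt1 P     ≈⟨ ConvergesTo-unique Qa≋P (polynomial*-ConvergesTo Q lim) (polynomial-ConvergesTo P) ⟨
    polynomialAt1 Q * T ≈⟨ *-comm _ _ ⟩
    T * polynomialAt1 Q ∎)

  SumsTo-unique : ∀ {a S T} → a SumsTo S → a SumsTo T → S ≈ T
  SumsTo-unique {a} {S} {T} (P , Q , Qa≋P , Q#0 , SQ≈P) (P′ , Q′ , Q′a≋P′ , Q′#0 , TQ′≈P′) =
    *-cancelʳ-# Q#0 (*-cancelʳ-# Q′#0 (begin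
      S * polynomialAt1 Q * polynomialAt1 Q′  ≈⟨ *-congʳ SQ≈P ⟩
      polynomialAt1 P * polynomialAt1 Q′      ≈⟨ *-comm _ _ ⟩
      polynomialAt1 Q′ * polynomialAt1 P      ≈⟨ ConvergesTo-unique Q′P≋QP′
                                                   (polynomial*-ConvergesTo Q′ (polynomial-ConvergesTo P))
                                                   (polynomial*-ConvergesTo Q (polynomial-ConvergesTo P′)) ⟩
      polynomialAt1 Q * polynomialAt1 P′      ≈⟨ *-congˡ TQ′≈P′ ⟨
      polynomialAt1 Q * (T * polynomialAt1 Q′) ≈⟨ *-swapˡ _ _ _ ⟩
      T * (polynomialAt1 Q * polynomialAt1 Q′) ≈⟨ *-assoc _ _ _ ⟨
      T * polynomialAt1 Q * polynomialAt1 Q′  ∎))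
    where
    q q′ : Series
    q  = polynomial Q
    q′ = polynomial Q′
    Q′P≋QP′ : q′ *ₛ polynomial P ≋ q *ₛ polynomial P′
    Q′P≋QP′ n = begin
      (q′ *ₛ polynomial P) n ≈⟨ *ₛ-cong {q′} (λ _ → refl) Qa≋P n ⟨
      (q′ *ₛ (q *ₛ a)) n     ≈⟨ *ₛ-assoc q′ q a n ⟨
      ((q′ *ₛ q) *ₛ a) n     ≈⟨ *ₛ-cong {g = a} (*ₛ-comm q′ q) (λ _ → refl) n ⟩
      ((q *ₛ q′) *ₛ a) n     ≈⟨ *ₛ-assoc q q′ a n ⟩
      (q *ₛ (q′ *ₛ a)) n     ≈⟨ *ₛ-cong {q} (λ _ → refl) Q′a≋P′ n ⟩
      (q *ₛ polynomial P′) n ∎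

{-# OPTIONS --safe #-}
-- With n_r = n_{r-1} + j, the expansion of (n_{r-1} + j)^(-k_r) in powers of n_{r-1}/j
-- gives Li_{k₁,…,k_r}(u) = Σⱼ Σₘ binom(-k_r,m) j^(-k_r-m) uʲ Li_{k₁,…,k_{r-1}-m}(u) at
-- u = 1 - e⁻ᵗ, and uʲ/t is a generating function of Stirling numbers. A single
-- coefficient of tⁿ only involves finitely many values p of n_{r-1}, so it is enough to
-- sum Σₘ binom(-k_r,m) pᵐ j^(-k_r-m) = (p + j)^(-k_r): as power series in z, these terms
-- A_k satisfy (j + p z) A_{k+1} = A_k by Pascal's rule, and A_0 = 1, so that they are
-- rational with a denominator that is positive at z = 1.

module Submission where

open import Defs
import Algebra.Properties.AbelianGroup as AbelianGroupProperties
import Algebra.Properties.CommutativeSemigroup as CommutativeSemigroupProperties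
import Algebra.Properties.Monoid.Mult as MonoidMult
import Algebra.Properties.Ring as RingProperties
import Algebra.Properties.Semiring.Exp as SemiringExp
import Algebra.Properties.Semiring.Mult as SemiringMult
import Algebra.Solver.Ring.NaturalCoefficients.Default as SemiringSolver
open import Data.Fin.Base as Fin using ()
import Data.Fin.Properties as Finₚ
open import Data.Integer.Base as ℤ using (ℤ; +_; -[1+_])
import Data.Integer.Properties as ℤₚ
import Data.Integer.Tactic.RingSolver as ℤSolver
open import Data.List.Base using (List; []; _∷_)
open import Data.Nat.Base as ℕ using (ℕ; zero; suc; _!; z≤n; s≤s)
open import Data.Nat.Combinatorics using (_C_; k![n∸k]!∣n!)
open import Data.Nat.Combinatorics.Specification using (nCk≡n!/k![n-k]!)
open import Data.Nat.DivMod using (m/n*n≡m)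
import Data.Nat.Properties as ℕₚ
open import Data.Product.Base using (∃; _×_; _,_)
open import Data.Sum.Base using (_⊎_; inj₁; inj₂)
open import Data.Vec.Functional using (Vector; init; last; updateAt)
open import Data.Vec.Functional.Properties using (updateAt-updates; updateAt-minimal)
open import Level using (_⊔_)
open import Relation.Binary.PropositionalEquality as ≡ using (_≡_; _≗_)
import Relation.Binary.Reasoning.Setoid as SetoidReasoning

-- The obstacle is the sum over m: for k_r ≥ 1 it may diverge, as soon as some n_{r-1} is at least
-- the gap j, so limits cannot be exchanged analytically. Linearity replaces convergence: for fixed
-- n, each number with last index k_{r-1} - m is a combination of the powers pᵐ, where p runs below
-- a bound that does not depend on m, and sums of rational series add. What remains is an identity
-- between finite sums. It rests on (uʲ/t) · (uᵖ e_λˣ/d^(r-1)) · (t/d) = u^(p+j) e_λˣ/dʳ, where d =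
-- e_λ(t) - 1. The three factors account for the Stirling numbers, the numbers with r - 1 indices
-- and Carlitz's numbers, the two binomial coefficients come from the convolutions, and the leading
-- r is r!/(r-1)!. The variable n_r of the theorem is the gap j, not the last summation index of the
-- polylogarithm. Splitting off d^(r-1) loses terms of the numerator when p < r - 1; such p are
-- harmless because the polylogarithm with r - 1 indices has no coefficient there.

module _ {c ℓ₁ ℓ₂} (ℝ : RealField c ℓ₁ ℓ₂) where
  open RealField ℝ
  open DegenerateBernoulli ℝ
  open SetoidReasoning setoid
  open CommutativeSemigroupProperties +-commutativeSemigroup using () renaming (interchange to +-interchange)
  open CommutativeSemigroupProperties *-commutativeSemigroup using ()
    renaming (interchange to *-interchange; x∙yz≈y∙xz to *-swapˡ)
  open MonoidMult +-monoid using () renaming (×-homo-+ to ·-homo-+)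
  open SemiringMult semiring using () renaming (×1-homo-* to fromℕ-*)
  open SemiringExp semiring using (^-homo-*)
  open RingProperties ring using (-1*x≈-x; -‿involutive; -0#≈0#; -‿+-comm; x[y-z]≈xy-xz)
  open AbelianGroupProperties +-abelianGroup using () renaming (⁻¹-anti-homo‿- to -‿anti-homo--)
  open SemiringSolver commutativeSemiring using (solve; _:=_; _:+_; _:*_)

  -- Finite sums

  ∑-cong< : ∀ n {f g} → (∀ i → i ℕ.< n → f i ≈ g i) → ∑< n f ≈ ∑< n g
  ∑-cong< zero    f≈g = refl
  ∑-cong< (suc n) f≈g = +-cong (f≈g 0 (s≤s z≤n)) (∑-cong< n λ i i<n → f≈g (suc i) (s≤s i<n))

  ∑-cong : ∀ n {f g} → (∀ i → f i ≈ g i) → ∑< n f ≈ ∑< n g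
  ∑-cong n f≈g = ∑-cong< n λ i _ → f≈g i

  ∑-zero : ∀ n {f} → (∀ i → i ℕ.< n → f i ≈ 0#) → ∑< n f ≈ 0#
  ∑-zero zero    f≈0 = refl
  ∑-zero (suc n) f≈0 = trans (+-cong (f≈0 0 (s≤s z≤n)) (∑-zero n λ i i<n → f≈0 (suc i) (s≤s i<n))) (+-identityˡ 0#)

  ∑-+ : ∀ n f g → ∑< n (λ i → f i + g i) ≈ ∑< n f + ∑< n g
  ∑-+ zero    f g = sym (+-identityˡ 0#)
  ∑-+ (suc n) f g = trans (+-congˡ (∑-+ n (λ i → f (suc i)) (λ i → g (suc i)))) (+-interchange _ _ _ _)

  ∑-*ˡ : ∀ n a f → ∑< n (λ i → a * f i) ≈ a * ∑< n f
  ∑-*ˡ zero    a f = sym (zeroʳ a)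
  ∑-*ˡ (suc n) a f = trans (+-congˡ (∑-*ˡ n a (λ i → f (suc i)))) (sym (distribˡ a _ _))

  ∑-*ʳ : ∀ n a f → ∑< n (λ i → f i * a) ≈ ∑< n f * a
  ∑-*ʳ n a f = trans (∑-cong n λ i → *-comm (f i) a) (trans (∑-*ˡ n a f) (*-comm a _))

  ∑-last : ∀ n f → ∑< (suc n) f ≈ ∑< n f + f n
  ∑-last zero    f = trans (+-identityʳ _) (sym (+-identityˡ _))
  ∑-last (suc n) f = trans (+-congˡ (∑-last n (λ i → f (suc i)))) (sym (+-assoc _ _ _))

  ∑-swap : ∀ m n (f : ℕ → ℕ → Carrier) → ∑< m (λ i → ∑< n (f i)) ≈ ∑< n (λ j → ∑< m (λ i → f i j))
  ∑-swap zero    n f = sym (∑-zero n λ _ _ → refl)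
  ∑-swap (suc m) n f = trans (+-congˡ (∑-swap m n (λ i → f (suc i)))) (sym (∑-+ n (f 0) _))

  ∑-swap₃ : ∀ a b d (f : ℕ → ℕ → ℕ → Carrier) →
    ∑< a (λ i → ∑< b λ j → ∑< d λ p → f i j p) ≈ ∑< b (λ j → ∑< d λ p → ∑< a λ i → f i j p)
  ∑-swap₃ a b d f = trans (∑-swap a b (λ i j → ∑< d (f i j))) (∑-cong b λ j → ∑-swap a d (λ i → f i j))

  ∑-extend : ∀ {n M} f → n ℕ.≤ M → (∀ j → n ℕ.≤ j → f j ≈ 0#) → ∑< n f ≈ ∑< M f
  ∑-extend {M = M} f z≤n f≈0 = sym (∑-zero M λ i _ → f≈0 i z≤n)
  ∑-extend f (s≤s n≤M) f≈0   = +-congˡ (∑-extend (λ i → f (suc i)) n≤M λ j n≤j → f≈0 (suc j) (s≤s n≤j))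

  ∑-reverse : ∀ n f → ∑< (suc n) f ≈ ∑< (suc n) (λ i → f (n ℕ.∸ i))
  ∑-reverse zero    f = refl
  ∑-reverse (suc n) f = begin
    ∑< (suc (suc n)) f                        ≈⟨ ∑-last (suc n) f ⟩
    ∑< (suc n) f + f (suc n)                  ≈⟨ +-comm _ _ ⟩
    f (suc n) + ∑< (suc n) f                  ≈⟨ +-congˡ (∑-reverse n f) ⟩
    f (suc n) + ∑< (suc n) (λ i → f (n ℕ.∸ i)) ∎

  -- The substitution `N = i + j`. It serves both associativity of the Cauchy product and the
  -- passage from the last polylogarithm index to the gap between the last two.
  ∑-triangle : ∀ M (F : ℕ → ℕ → Carrier) →
    ∑< M (λ N → ∑< (suc N) λ i → F i (N ℕ.∸ i)) ≈ ∑< M (λ i → ∑< (M ℕ.∸ i) (F i))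
  ∑-triangle zero    F = refl
  ∑-triangle (suc M) F = begin
    ∑< (suc M) (λ N → F 0 N + rest N)
      ≈⟨ ∑-+ (suc M) (F 0) rest ⟩
    ∑< (suc M) (F 0) + (0# + ∑< M (λ N → ∑< (suc N) λ i → F (suc i) (N ℕ.∸ i)))
      ≈⟨ +-congˡ (trans (+-identityˡ _) (∑-triangle M (λ i → F (suc i)))) ⟩
    ∑< (suc M) (F 0) + ∑< M (λ i → ∑< (M ℕ.∸ i) (F (suc i))) ∎
    where
    rest : ℕ → Carrier
    rest N = ∑< N λ i → F (suc i) (N ℕ.∸ suc i)

  -- Formal power series

  infixl 6 _+ₛ_

  _+ₛ_ : Series → Series → Series
  (f +ₛ g) n = f n + g n

  *ₛ-cong≤ : ∀ n {f f′ g g′} → (∀ i → i ℕ.≤ n → f i ≈ f′ i) → (∀ i → i ℕ.≤ n → g i ≈ g′ i) →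
             (f *ₛ g) n ≈ (f′ *ₛ g′) n
  *ₛ-cong≤ n f≈ g≈ = ∑-cong< (suc n) λ i i<1+n → *-cong (f≈ i (ℕₚ.≤-pred i<1+n)) (g≈ _ (ℕₚ.m∸n≤m n i))

  *ₛ-congʳ : ∀ {f f′} g → f ≋ f′ → f *ₛ g ≋ f′ *ₛ g
  *ₛ-congʳ g f≈ n = *ₛ-cong≤ n {g = g} (λ i _ → f≈ i) (λ _ _ → refl)

  *ₛ-congˡ : ∀ f {g g′} → g ≋ g′ → f *ₛ g ≋ f *ₛ g′
  *ₛ-congˡ f g≈ n = *ₛ-cong≤ n {f = f} (λ _ _ → refl) (λ i _ → g≈ i)

  *ₛ-zeroˡ : ∀ n {f} g → (∀ i → i ℕ.≤ n → f i ≈ 0#) → (f *ₛ g) n ≈ 0#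
  *ₛ-zeroˡ n g f≈0 = ∑-zero (suc n) λ i i<1+n → trans (*-congʳ (f≈0 i (ℕₚ.≤-pred i<1+n))) (zeroˡ (g (n ℕ.∸ i)))

  *ₛ-comm : ∀ f g → f *ₛ g ≋ g *ₛ f
  *ₛ-comm f g n = trans (∑-reverse n (λ i → f i * g (n ℕ.∸ i))) (∑-cong< (suc n) λ i i<1+n →
    trans (*-comm (f (n ℕ.∸ i)) _) (*-congʳ (reflexive (≡.cong g (ℕₚ.m∸[m∸n]≡n (ℕₚ.≤-pred i<1+n))))))

  *ₛ-identityˡ : ∀ f → 1ₛ *ₛ f ≋ f
  *ₛ-identityˡ f n = trans (+-cong (*-identityˡ _) (∑-zero n λ i _ → zeroˡ (f (n ℕ.∸ suc i)))) (+-identityʳ _)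

  *ₛ-identityʳ : ∀ f → f *ₛ 1ₛ ≋ f
  *ₛ-identityʳ f n = trans (*ₛ-comm f 1ₛ n) (*ₛ-identityˡ f n)

  *ₛ-assoc : ∀ f g h → (f *ₛ g) *ₛ h ≋ f *ₛ (g *ₛ h)
  *ₛ-assoc f g h n = begin
    ∑< (suc n) (λ a → ∑< (suc a) (λ i → f i * g (a ℕ.∸ i)) * h (n ℕ.∸ a))
      ≈⟨ ∑-cong (suc n) (λ a → trans (sym (∑-*ʳ (suc a) (h (n ℕ.∸ a)) (λ i → f i * g (a ℕ.∸ i))))
           (∑-cong< (suc a) λ i i≤a → trans (*-assoc (f i) (g (a ℕ.∸ i)) (h (n ℕ.∸ a))) (*-congˡ (*-congˡ
             (reflexive (≡.cong (λ b → h (n ℕ.∸ b)) (≡.sym (ℕₚ.m+[n∸m]≡n (ℕₚ.≤-pred i≤a))))))))) ⟩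
    ∑< (suc n) (λ a → ∑< (suc a) λ i → F i (a ℕ.∸ i))
      ≈⟨ ∑-triangle (suc n) F ⟩
    ∑< (suc n) (λ i → ∑< (suc n ℕ.∸ i) (F i))
      ≈⟨ ∑-cong< (suc n) (λ i i≤n → trans
           (reflexive (≡.cong (λ b → ∑< b (F i)) (ℕₚ.+-∸-assoc 1 (ℕₚ.≤-pred i≤n))))
           (trans (∑-cong (suc (n ℕ.∸ i)) λ j → *-congˡ {f i} (*-congˡ {g j} (reflexive (≡.cong h (≡.sym (ℕₚ.∸-+-assoc n i j))))))
             (∑-*ˡ (suc (n ℕ.∸ i)) (f i) (λ j → g j * h (n ℕ.∸ i ℕ.∸ j))))) ⟩
    ∑< (suc n) (λ i → f i * ∑< (suc (n ℕ.∸ i)) (λ j → g j * h (n ℕ.∸ i ℕ.∸ j))) ∎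
    where
    F : ℕ → ℕ → Carrier
    F i j = f i * (g j * h (n ℕ.∸ (i ℕ.+ j)))

  *ₛ-distribˡ : ∀ f g h → f *ₛ (g +ₛ h) ≋ f *ₛ g +ₛ f *ₛ h
  *ₛ-distribˡ f g h n = trans (∑-cong (suc n) λ i → distribˡ (f i) (g (n ℕ.∸ i)) (h (n ℕ.∸ i)))
    (∑-+ (suc n) (λ i → f i * g (n ℕ.∸ i)) (λ i → f i * h (n ℕ.∸ i)))

  *ₛ-scaleʳ : ∀ a f g → f *ₛ (a ∙ₛ g) ≋ a ∙ₛ (f *ₛ g)
  *ₛ-scaleʳ a f g n = trans (∑-cong (suc n) λ i → *-swapˡ (f i) a (g (n ℕ.∸ i)))
    (∑-*ˡ (suc n) a λ i → f i * g (n ℕ.∸ i))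

  -- The expansion of `f` is asked for only up to degree `n`, so that `M` may depend on `n`. A
  -- composite, whose number of terms grows with the degree, can thus be treated as a fixed finite
  -- combination.
  *ₛ-∑ˡ : ∀ n M {f} (φ : ℕ → Carrier) (G : ℕ → Series) g →
    (∀ i → i ℕ.≤ n → f i ≈ ∑< M (λ p → φ p * G p i)) → (f *ₛ g) n ≈ ∑< M (λ p → φ p * (G p *ₛ g) n)
  *ₛ-∑ˡ n M {f} φ G g f≈ = begin
    ∑< (suc n) (λ i → f i * g (n ℕ.∸ i))
      ≈⟨ ∑-cong< (suc n) (λ i i<1+n → trans (*-congʳ (f≈ i (ℕₚ.≤-pred i<1+n)))
           (trans (sym (∑-*ʳ M (g (n ℕ.∸ i)) (λ p → φ p * G p i)))
             (∑-cong M λ p → *-assoc (φ p) (G p i) (g (n ℕ.∸ i))))) ⟩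
    ∑< (suc n) (λ i → ∑< M (λ p → φ p * (G p i * g (n ℕ.∸ i))))
      ≈⟨ ∑-swap (suc n) M (λ i p → φ p * (G p i * g (n ℕ.∸ i))) ⟩
    ∑< M (λ p → ∑< (suc n) (λ i → φ p * (G p i * g (n ℕ.∸ i))))
      ≈⟨ ∑-cong M (λ p → ∑-*ˡ (suc n) (φ p) (λ i → G p i * g (n ℕ.∸ i))) ⟩
    ∑< M (λ p → φ p * (G p *ₛ g) n) ∎

  shift1-*ₛ : ∀ {f} g → f 0 ≈ 0# → shift 1 (f *ₛ g) ≋ shift 1 f *ₛ g
  shift1-*ₛ g f₀≈0 n = trans (+-congʳ (trans (*-congʳ f₀≈0) (zeroˡ _))) (+-identityˡ _)

  -- Division by `tˢ` moves into a factor only if that factor loses no terms; this is the origin of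
  -- `s ≤ p` in `W-step`.
  *ₛ-shift : ∀ s f {g} → (∀ i → i ℕ.< s → g i ≈ 0#) → shift s (f *ₛ g) ≋ f *ₛ shift s g
  *ₛ-shift zero    f     g≈0 n = refl
  *ₛ-shift (suc s) f {g} g≈0 n = begin
    (f *ₛ g) (suc (s ℕ.+ n))       ≈⟨ *ₛ-comm f g _ ⟩
    (g *ₛ f) (suc (s ℕ.+ n))       ≈⟨ shift1-*ₛ {g} f (g≈0 0 (s≤s z≤n)) (s ℕ.+ n) ⟩
    (shift 1 g *ₛ f) (s ℕ.+ n)     ≈⟨ *ₛ-comm (shift 1 g) f _ ⟩
    (f *ₛ shift 1 g) (s ℕ.+ n)     ≈⟨ *ₛ-shift s f {shift 1 g} (λ i i<s → g≈0 (suc i) (s≤s i<s)) n ⟩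
    (f *ₛ shift s (shift 1 g)) n   ∎

  ^ₛ-order : ∀ {v} → v 0 ≈ 0# → ∀ j n → n ℕ.< j → (v ^ₛ j) n ≈ 0#
  ^ₛ-order v₀≈0 (suc j) zero    n<j = trans (+-identityʳ _) (trans (*-congʳ v₀≈0) (zeroˡ _))
  ^ₛ-order {v} v₀≈0 (suc j) (suc n) (s≤s n<j) = trans (shift1-*ₛ {v} (v ^ₛ j) v₀≈0 n)
    (trans (*ₛ-comm (shift 1 v) (v ^ₛ j) n)
      (*ₛ-zeroˡ n (shift 1 v) λ i i≤n → ^ₛ-order {v} v₀≈0 j i (ℕₚ.≤-<-trans i≤n n<j)))

  ^ₛ-homo-*ₛ : ∀ v i j → v ^ₛ (i ℕ.+ j) ≋ v ^ₛ i *ₛ v ^ₛ j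
  ^ₛ-homo-*ₛ v zero    j n = sym (*ₛ-identityˡ (v ^ₛ j) n)
  ^ₛ-homo-*ₛ v (suc i) j n = trans (*ₛ-congˡ v (^ₛ-homo-*ₛ v i j) n) (sym (*ₛ-assoc v (v ^ₛ i) (v ^ₛ j) n))

  compose-∑ : ∀ f {v} → v 0 ≈ 0# → ∀ {n M} → n ℕ.< M → compose f v n ≈ ∑< M (λ p → f p * (v ^ₛ p) n)
  compose-∑ f {v} v₀≈0 {n} n<M = ∑-extend (λ p → f p * (v ^ₛ p) n) n<M
    λ p n<p → trans (*-congˡ (^ₛ-order v₀≈0 p n n<p)) (zeroʳ (f p))

  -- Rational generating functions

  infix 4 _FinitelySumsTo_ _PositivelySumsTo_

  -- A polynomial, encoded as an eventually zero coefficient function, with its value at 1. Addition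
  -- and scaling then need no arithmetic on coefficient lists; `FinitelySumsTo⇒polynomial` produces
  -- a list where `_SumsTo_` asks for one.
  _FinitelySumsTo_ : Series → Carrier → Set ℓ₁
  a FinitelySumsTo S = ∃ λ N → (∀ m → N ℕ.≤ m → a m ≈ 0#) × (∑< N a ≈ S)

  FinitelySumsTo-cong : ∀ {a b S T} → a ≋ b → S ≈ T → a FinitelySumsTo S → b FinitelySumsTo T
  FinitelySumsTo-cong a≋b S≈T (N , a≈0 , ∑a) =
    N , (λ m N≤m → trans (sym (a≋b m)) (a≈0 m N≤m)) , trans (∑-cong N λ m → sym (a≋b m)) (trans ∑a S≈T)

  FinitelySumsTo-+ : ∀ {a b S T} → a FinitelySumsTo S → b FinitelySumsTo T → a +ₛ b FinitelySumsTo S + T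
  FinitelySumsTo-+ {a} {b} (M , a≈0 , ∑a) (N , b≈0 , ∑b) = M ℕ.⊔ N ,
    (λ m M⊔N≤m → trans (+-cong (a≈0 m (ℕₚ.m⊔n≤o⇒m≤o M N M⊔N≤m)) (b≈0 m (ℕₚ.m⊔n≤o⇒n≤o M N M⊔N≤m))) (+-identityˡ 0#)) ,
    trans (∑-+ (M ℕ.⊔ N) a b) (+-cong
      (trans (sym (∑-extend a (ℕₚ.m≤m⊔n M N) a≈0)) ∑a)
      (trans (sym (∑-extend b (ℕₚ.m≤n⊔m M N) b≈0)) ∑b))

  FinitelySumsTo-∙ : ∀ c {a S} → a FinitelySumsTo S → c ∙ₛ a FinitelySumsTo c * S
  FinitelySumsTo-∙ c {a} (N , a≈0 , ∑a) =
    N , (λ m N≤m → trans (*-congˡ (a≈0 m N≤m)) (zeroʳ c)) , trans (∑-*ˡ N c a) (*-congˡ ∑a)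

  FinitelySumsTo-t : ∀ {a b S} → b 0 ≈ 0# → shift 1 b ≋ a → a FinitelySumsTo S → b FinitelySumsTo S
  FinitelySumsTo-t b₀≈0 tail≋a (N , a≈0 , ∑a) =
    suc N , (λ { (suc m) (s≤s N≤m) → trans (tail≋a m) (a≈0 m N≤m) }) ,
    trans (+-cong b₀≈0 (trans (∑-cong N tail≋a) ∑a)) (+-identityˡ _)

  -- Horner's scheme: (q + t Q) a = q a + t (Q a), and the factor t does not change the value at 1.
  FinitelySumsTo-polynomial* : ∀ Q {a S} → a FinitelySumsTo S →
    polynomial Q *ₛ a FinitelySumsTo polynomialAt1 Q * S
  FinitelySumsTo-polynomial* [] {a} {S} _ =
    0 , (λ m _ → *ₛ-zeroˡ m a λ _ _ → refl) , sym (zeroˡ S)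
  FinitelySumsTo-polynomial* (q ∷ Q) {a} {S} a-sum = FinitelySumsTo-cong split (sym (distribʳ S q _))
    (FinitelySumsTo-+ (FinitelySumsTo-∙ q a-sum)
      (FinitelySumsTo-t {b = tQa} refl (λ _ → refl) (FinitelySumsTo-polynomial* Q a-sum)))
    where
    tQa : Series
    tQa zero    = 0#
    tQa (suc m) = (polynomial Q *ₛ a) m
    split : q ∙ₛ a +ₛ tQa ≋ polynomial (q ∷ Q) *ₛ a
    split zero    = refl
    split (suc m) = refl

  FinitelySumsTo-polynomial : ∀ P → polynomial P FinitelySumsTo polynomialAt1 P
  FinitelySumsTo-polynomial P = FinitelySumsTo-cong (*ₛ-identityʳ (polynomial P)) (*-identityʳ _)
    (FinitelySumsTo-polynomial* P (1 , (λ { (suc m) _ → refl }) , +-identityʳ 1#))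

  FinitelySumsTo⇒polynomial : ∀ {a S} → a FinitelySumsTo S → ∃ λ P → (a ≋ polynomial P) × (polynomialAt1 P ≈ S)
  FinitelySumsTo⇒polynomial {a} {S} (N , a≈0 , ∑a) = truncate N a , truncate≋ N a a≈0 , trans (truncateAt1 N a) ∑a
    where
    truncate : ℕ → Series → List Carrier
    truncate zero    b = []
    truncate (suc N) b = b 0 ∷ truncate N (shift 1 b)
    truncate≋ : ∀ N b → (∀ m → N ℕ.≤ m → b m ≈ 0#) → b ≋ polynomial (truncate N b)
    truncate≋ zero    b b≈0 m       = b≈0 m z≤n
    truncate≋ (suc N) b b≈0 zero    = refl
    truncate≋ (suc N) b b≈0 (suc m) = truncate≋ N (shift 1 b) (λ i N≤i → b≈0 (suc i) (s≤s N≤i)) m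
    truncateAt1 : ∀ N b → polynomialAt1 (truncate N b) ≈ ∑< N b
    truncateAt1 zero    b = refl
    truncateAt1 (suc N) b = +-congˡ (truncateAt1 N (shift 1 b))

  FinitelySumsTo⇒ConvergesTo : ∀ {a S} → a FinitelySumsTo S → a ConvergesTo S
  FinitelySumsTo⇒ConvergesTo {a} {S} (N , a≈0 , ∑a) ε 0<ε = N , λ n N≤n →
    let ∑≈S = trans (sym (∑-extend a N≤n a≈0)) ∑a
    in <-respˡ-≈ (sym ∑≈S) S<S+ε , <-respʳ-≈ (+-congʳ (sym ∑≈S)) S<S+ε
    where
    S<S+ε : S < S + ε
    S<S+ε = <-respˡ-≈ (+-identityʳ S) (+-monoˡ-< S 0<ε)

  -- The positivity of Q(1) makes these sums closed under addition with the plain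
  -- product of the denominators, without a case analysis on signs.
  _PositivelySumsTo_ : Series → Carrier → Set (c ⊔ ℓ₁ ⊔ ℓ₂)
  a PositivelySumsTo S = ∃ λ Q → (0# < polynomialAt1 Q) × (polynomial Q *ₛ a FinitelySumsTo polynomialAt1 Q * S)

  PositivelySumsTo⇒SumsTo : ∀ {a S} → a PositivelySumsTo S → a SumsTo S
  PositivelySumsTo⇒SumsTo {S = S} (Q , 0<Q , Qa-sum) with FinitelySumsTo⇒polynomial Qa-sum
  ... | P , Qa≋P , P≈QS = P , Q , Qa≋P , inj₂ 0<Q , trans (*-comm S _) (sym P≈QS)

  FinitelySumsTo⇒PositivelySumsTo : ∀ {a S} → a FinitelySumsTo S → a PositivelySumsTo S
  FinitelySumsTo⇒PositivelySumsTo a-sum =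
    1# ∷ [] , <-respʳ-≈ (sym (+-identityʳ 1#)) 0<1 , FinitelySumsTo-polynomial* (1# ∷ []) a-sum

  PositivelySumsTo-cong : ∀ {a b S T} → a ≋ b → S ≈ T → a PositivelySumsTo S → b PositivelySumsTo T
  PositivelySumsTo-cong a≋b S≈T (Q , 0<Q , Qa-sum) =
    Q , 0<Q , FinitelySumsTo-cong (*ₛ-congˡ (polynomial Q) a≋b) (*-congˡ S≈T) Qa-sum

  PositivelySumsTo-∙ : ∀ c {a S} → a PositivelySumsTo S → c ∙ₛ a PositivelySumsTo c * S
  PositivelySumsTo-∙ c {a} {S} (Q , 0<Q , Qa-sum) = Q , 0<Q ,
    FinitelySumsTo-cong (λ m → sym (*ₛ-scaleʳ c (polynomial Q) a m)) (*-swapˡ c _ S) (FinitelySumsTo-∙ c Qa-sum)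

  PositivelySumsTo-+ : ∀ {a b S T} → a PositivelySumsTo S → b PositivelySumsTo T → a +ₛ b PositivelySumsTo S + T
  PositivelySumsTo-+ {a} {b} {S} {T} (Q , 0<Q , Qa-sum) (R , 0<R , Rb-sum)
    -- The coefficient list of the product of `Q` and `R`, together with its value at 1, is read off
    -- from the product series.
    with FinitelySumsTo⇒polynomial (FinitelySumsTo-polynomial* Q (FinitelySumsTo-polynomial R))
  ... | QR , Q*R≋QR , QR≈Q*R = QR , <-respʳ-≈ (sym QR≈Q*R) (*-pos 0<Q 0<R) ,
    FinitelySumsTo-cong terms value
      (FinitelySumsTo-+ (FinitelySumsTo-polynomial* R Qa-sum) (FinitelySumsTo-polynomial* Q Rb-sum))
    where
    q r : Series
    q = polynomial Q
    r = polynomial R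
    terms : r *ₛ (q *ₛ a) +ₛ q *ₛ (r *ₛ b) ≋ polynomial QR *ₛ (a +ₛ b)
    terms m = begin
      (r *ₛ (q *ₛ a)) m + (q *ₛ (r *ₛ b)) m
        ≈⟨ +-cong (trans (sym (*ₛ-assoc r q a m)) (*ₛ-congʳ a (*ₛ-comm r q) m)) (sym (*ₛ-assoc q r b m)) ⟩
      ((q *ₛ r) *ₛ a) m + ((q *ₛ r) *ₛ b) m
        ≈⟨ *ₛ-distribˡ (q *ₛ r) a b m ⟨
      ((q *ₛ r) *ₛ (a +ₛ b)) m
        ≈⟨ *ₛ-congʳ (a +ₛ b) Q*R≋QR m ⟩
      (polynomial QR *ₛ (a +ₛ b)) m ∎
    value : polynomialAt1 R * (polynomialAt1 Q * S) + polynomialAt1 Q * (polynomialAt1 R * T) ≈ polynomialAt1 QR * (S + T)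
    value = trans
      (solve 4 (λ q r s t → r :* (q :* s) :+ q :* (r :* t) := (q :* r) :* (s :+ t)) refl
        (polynomialAt1 Q) (polynomialAt1 R) S T)
      (*-congʳ (sym QR≈Q*R))

  PositivelySumsTo-∑ : ∀ M (a : ℕ → Series) {S : ℕ → Carrier} → (∀ p → a p PositivelySumsTo S p) →
    (λ m → ∑< M (λ p → a p m)) PositivelySumsTo ∑< M S
  PositivelySumsTo-∑ zero    a sums = FinitelySumsTo⇒PositivelySumsTo (0 , (λ _ _ → refl) , refl)
  PositivelySumsTo-∑ (suc M) a sums = PositivelySumsTo-+ (sums 0) (PositivelySumsTo-∑ M (λ p → a (suc p)) λ p → sums (suc p))

  -- `R` is absorbed by the numerator while the denominator `Q` stays. This serves the passage from
  -- `k + 1` to `k` in `negBinomTerm-sum`.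
  PositivelySumsTo-polynomial* : ∀ R {a b S} → polynomial R *ₛ a ≋ b →
    a PositivelySumsTo S → b PositivelySumsTo polynomialAt1 R * S
  PositivelySumsTo-polynomial* R {a} {b} {S} Ra≋b (Q , 0<Q , Qa-sum) = Q , 0<Q ,
    FinitelySumsTo-cong terms (*-swapˡ _ _ S) (FinitelySumsTo-polynomial* R Qa-sum)
    where
    q r : Series
    q = polynomial Q
    r = polynomial R
    terms : r *ₛ (q *ₛ a) ≋ q *ₛ b
    terms m = begin
      (r *ₛ (q *ₛ a)) m ≈⟨ *ₛ-assoc r q a m ⟨
      ((r *ₛ q) *ₛ a) m ≈⟨ *ₛ-congʳ a (*ₛ-comm r q) m ⟩
      ((q *ₛ r) *ₛ a) m ≈⟨ *ₛ-assoc q r a m ⟩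
      (q *ₛ (r *ₛ a)) m ≈⟨ *ₛ-congˡ q Ra≋b m ⟩
      (q *ₛ b) m        ∎

  -- Division by `R`, which joins the denominator and therefore has to be positive at 1. This serves
  -- the passage from `k` to `k + 1`.
  PositivelySumsTo-polynomial⁻¹* : ∀ R {a b S} → 0# < polynomialAt1 R → polynomial R *ₛ a ≋ b →
    b PositivelySumsTo polynomialAt1 R * S → a PositivelySumsTo S
  PositivelySumsTo-polynomial⁻¹* R {a} {b} {S} 0<R Ra≋b (Q , 0<Q , Qb-sum)
    with FinitelySumsTo⇒polynomial (FinitelySumsTo-polynomial* Q (FinitelySumsTo-polynomial R))
  ... | QR , Q*R≋QR , QR≈Q*R = QR , <-respʳ-≈ (sym QR≈Q*R) (*-pos 0<Q 0<R) ,
    FinitelySumsTo-cong terms (trans (sym (*-assoc _ _ S)) (*-congʳ (sym QR≈Q*R))) Qb-sum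
    where
    terms : polynomial Q *ₛ b ≋ polynomial QR *ₛ a
    terms m = begin
      (polynomial Q *ₛ b) m                     ≈⟨ *ₛ-congˡ (polynomial Q) Ra≋b m ⟨
      (polynomial Q *ₛ (polynomial R *ₛ a)) m   ≈⟨ *ₛ-assoc (polynomial Q) (polynomial R) a m ⟨
      ((polynomial Q *ₛ polynomial R) *ₛ a) m   ≈⟨ *ₛ-congʳ a Q*R≋QR m ⟩
      (polynomial QR *ₛ a) m                    ∎

  -- Powers and binomial coefficients

  zpow-suc : ∀ a a#0 z → zpow a a#0 (ℤ.suc z) ≈ a * zpow a a#0 z
  zpow-suc a a#0 (+ n)          = refl
  zpow-suc a a#0 -[1+ zero ]    = sym (trans (*-congˡ (*-identityʳ _)) (recip-inverse a a#0))
  zpow-suc a a#0 -[1+ suc n ]   = begin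
    recip a a#0 ^ suc n                     ≈⟨ *-identityˡ _ ⟨
    1# * recip a a#0 ^ suc n                ≈⟨ *-congʳ (recip-inverse a a#0) ⟨
    a * recip a a#0 * recip a a#0 ^ suc n   ≈⟨ *-assoc _ _ _ ⟩
    a * (recip a a#0 * recip a a#0 ^ suc n) ∎

  zpow-+ : ∀ a a#0 m z → zpow a a#0 (+ m ℤ.+ z) ≈ a ^ m * zpow a a#0 z
  zpow-+ a a#0 zero    z = trans (reflexive (≡.cong (zpow a a#0) (ℤₚ.+-identityˡ z))) (sym (*-identityˡ _))
  zpow-+ a a#0 (suc m) z = begin
    zpow a a#0 (+ suc m ℤ.+ z)            ≡⟨ ≡.cong (zpow a a#0) (ℤₚ.+-assoc (+ 1) (+ m) z) ⟩
    zpow a a#0 (ℤ.suc (+ m ℤ.+ z))        ≈⟨ zpow-suc a a#0 (+ m ℤ.+ z) ⟩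
    a * zpow a a#0 (+ m ℤ.+ z)            ≈⟨ *-congˡ (zpow-+ a a#0 m z) ⟩
    a * (a ^ m * zpow a a#0 z)            ≈⟨ *-assoc _ _ _ ⟨
    a * a ^ m * zpow a a#0 z              ∎

  fromℤ-suc : ∀ z → fromℤ (ℤ.suc z) ≈ 1# + fromℤ z
  fromℤ-suc (+ n)        = refl
  fromℤ-suc -[1+ zero ]  = sym (trans (+-congˡ (-‿cong (+-identityʳ 1#))) (-‿inverseʳ 1#))
  fromℤ-suc -[1+ suc n ] = begin
    - fromℕ (suc n)                    ≈⟨ +-identityˡ _ ⟨
    0# - fromℕ (suc n)                 ≈⟨ +-congʳ (-‿inverseʳ 1#) ⟨
    1# - 1# - fromℕ (suc n)            ≈⟨ +-assoc _ _ _ ⟩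
    1# + (- 1# - fromℕ (suc n))        ≈⟨ +-congˡ (-‿+-comm 1# (fromℕ (suc n))) ⟩
    1# - fromℕ (suc (suc n))           ∎

  invFact-suc : ∀ m → invFact m ≈ fromℕ (suc m) * invFact (suc m)
  invFact-suc m = begin
    invFact m                                                             ≈⟨ *-identityʳ _ ⟨
    invFact m * 1#                                                        ≈⟨ *-congˡ (recip-inverse _ _) ⟨
    invFact m * (fromℕ (suc m !) * invFact (suc m))                       ≈⟨ *-congˡ (*-congʳ (fromℕ-* (suc m) (m !))) ⟩
    invFact m * (fromℕ (suc m) * fromℕ (m !) * invFact (suc m))           ≈⟨ solve 4 (λ i s f j → i :* (s :* f :* j) := (f :* i) :* (s :* j)) refl _ _ _ _ ⟩
    fromℕ (m !) * invFact m * (fromℕ (suc m) * invFact (suc m))           ≈⟨ *-congʳ (recip-inverse _ _) ⟩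
    1# * (fromℕ (suc m) * invFact (suc m))                                ≈⟨ *-identityˡ _ ⟩
    fromℕ (suc m) * invFact (suc m)                                       ∎

  invFact-0 : invFact 0 ≈ 1#
  invFact-0 = trans (sym (trans (*-congʳ (+-identityʳ 1#)) (*-identityˡ _))) (recip-inverse _ _)

  fallingFactorial-cong : ∀ m {x y} → x ≈ y → fallingFactorial x m ≈ fallingFactorial y m
  fallingFactorial-cong zero    x≈y = refl
  fallingFactorial-cong (suc m) x≈y = *-cong x≈y (fallingFactorial-cong m (+-congʳ x≈y))

  1+x-1≈x : ∀ x → 1# + x - 1# ≈ x
  1+x-1≈x x = trans (+-congʳ (+-comm 1# x)) (trans (+-assoc _ _ _) (trans (+-congˡ (-‿inverseʳ 1#)) (+-identityʳ x)))

  -- The definition peels off the factor `x`; Pascal's rule needs the factor at the other end.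
  fallingFactorial-last : ∀ x m → fallingFactorial x (suc m) ≈ fallingFactorial x m * (x - fromℕ m)
  fallingFactorial-last x zero    = begin
    x * 1#        ≈⟨ *-comm x 1# ⟩
    1# * x        ≈⟨ *-congˡ (trans (+-congˡ -0#≈0#) (+-identityʳ x)) ⟨
    1# * (x - 0#) ∎
  fallingFactorial-last x (suc m) = begin
    x * fallingFactorial (x - 1#) (suc m)                      ≈⟨ *-congˡ (fallingFactorial-last (x - 1#) m) ⟩
    x * (fallingFactorial (x - 1#) m * (x - 1# - fromℕ m))     ≈⟨ *-assoc _ _ _ ⟨
    x * fallingFactorial (x - 1#) m * (x - 1# - fromℕ m)       ≈⟨ *-congˡ (trans (+-assoc _ _ _) (+-congˡ (-‿+-comm 1# (fromℕ m)))) ⟩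
    x * fallingFactorial (x - 1#) m * (x - fromℕ (suc m))      ∎

  -- More than `a` factors a, a - 1, ... include 0.
  fallingFactorial-vanishes : ∀ a m → a ℕ.< m → fallingFactorial (fromℕ a) m ≈ 0#
  fallingFactorial-vanishes zero    (suc m) _         = zeroˡ _
  fallingFactorial-vanishes (suc a) (suc m) (s≤s a<m) =
    trans (*-congˡ (trans (fallingFactorial-cong m (1+x-1≈x (fromℕ a))) (fallingFactorial-vanishes a m a<m))) (zeroʳ _)

  binom-cong : ∀ m {x y} → x ≈ y → binom x m ≈ binom y m
  binom-cong m x≈y = *-congʳ (fallingFactorial-cong m x≈y)

  -- Write 1 + x = (m + 1) + (x - m): the first part cancels a factor of (m + 1)!, the second
  -- lengthens the falling factorial of `x`.
  binom-Pascal : ∀ x m → binom (1# + x) (suc m) ≈ binom x m + binom x (suc m)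
  binom-Pascal x m = begin
    (1# + x) * fallingFactorial (1# + x - 1#) m * J  ≈⟨ *-congʳ (*-congˡ (fallingFactorial-cong m (1+x-1≈x x))) ⟩
    (1# + x) * F * J                                 ≈⟨ *-congʳ (*-congʳ split) ⟩
    (fromℕ (suc m) + (x - fromℕ m)) * F * J          ≈⟨ solve 4 (λ s y f j → (s :+ y) :* f :* j := f :* (s :* j) :+ f :* y :* j) refl _ _ F J ⟩
    F * (fromℕ (suc m) * J) + F * (x - fromℕ m) * J  ≈⟨ +-cong (*-congˡ (invFact-suc m)) (*-congʳ (fallingFactorial-last x m)) ⟨
    binom x m + binom x (suc m)                      ∎
    where
    F J : Carrier
    F = fallingFactorial x m
    J = invFact (suc m)
    split : 1# + x ≈ fromℕ (suc m) + (x - fromℕ m)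
    split = sym (begin
      (1# + fromℕ m) + (x - fromℕ m) ≈⟨ +-interchange _ _ _ _ ⟩
      (1# + x) + (fromℕ m - fromℕ m) ≈⟨ +-congˡ (-‿inverseʳ _) ⟩
      (1# + x) + 0#                  ≈⟨ +-identityʳ _ ⟩
      1# + x                         ∎)

  -- The negative binomial series

  -- binom(-k,m), written with the upper index k + m - 1.
  negBinom : ℤ → ℕ → Carrier
  negBinom k m = binom (fromℤ (k ℤ.+ + m ℤ.- + 1)) m * (- 1#) ^ m

  -- This is Pascal's rule for binom(-k, m + 1). With upper index k + m - 1 it becomes Pascal's rule
  -- at `k + m`, where the opposite signs cancel the two occurrences of binom(k + m, m).
  negBinom-Pascal : ∀ k m → negBinom k (suc m) ≈ negBinom (ℤ.suc k) (suc m) + negBinom (ℤ.suc k) m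
  negBinom-Pascal k m = sym (begin
    negBinom (ℤ.suc k) (suc m) + negBinom (ℤ.suc k) m
      ≈⟨ +-cong (*-congʳ (trans (binom-cong (suc m) (trans (reflexive (≡.cong fromℤ (index₁ k (+ m)))) (fromℤ-suc (k ℤ.+ + m))))
                                (binom-Pascal x m)))
                (*-congʳ (reflexive (≡.cong (λ z → binom (fromℤ z) m) (index₂ k (+ m))))) ⟩
    (binom x m + binom x (suc m)) * (- 1# * e) + binom x m * e
      ≈⟨ solve 4 (λ b b′ n e → (b :+ b′) :* (n :* e) :+ b :* e := b′ :* (n :* e) :+ b :* (n :* e :+ e)) refl (binom x m) (binom x (suc m)) (- 1#) e ⟩
    binom x (suc m) * (- 1# * e) + binom x m * (- 1# * e + e)
      ≈⟨ +-congˡ (trans (*-congˡ (trans (+-congʳ (-1*x≈-x e)) (-‿inverseˡ e))) (zeroʳ _)) ⟩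
    binom x (suc m) * (- 1# * e) + 0#
      ≈⟨ +-identityʳ _ ⟩
    binom x (suc m) * (- 1# * e)
      ≡⟨ ≡.cong (λ z → binom (fromℤ z) (suc m) * (- 1# * e)) (index₃ k (+ m)) ⟨
    negBinom k (suc m) ∎)
    where
    x e : Carrier
    x = fromℤ (k ℤ.+ + m)
    e = (- 1#) ^ m
    index₁ : ∀ k m → (+ 1 ℤ.+ k) ℤ.+ (+ 1 ℤ.+ m) ℤ.- + 1 ≡ + 1 ℤ.+ (k ℤ.+ m)
    index₁ = ℤSolver.solve-∀
    index₂ : ∀ k m → (+ 1 ℤ.+ k) ℤ.+ m ℤ.- + 1 ≡ k ℤ.+ m
    index₂ = ℤSolver.solve-∀
    index₃ : ∀ k m → k ℤ.+ (+ 1 ℤ.+ m) ℤ.- + 1 ≡ k ℤ.+ m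
    index₃ = ℤSolver.solve-∀

  -- The upper index is here the natural number m - |k| - 1, which is less than `m`.
  negBinom-vanishes : ∀ k m → k ℤ.≤ + 0 → suc ℤ.∣ k ∣ ℕ.≤ m → negBinom k m ≈ 0#
  negBinom-vanishes k m k≤0 ∣k∣<m = trans (*-congʳ (trans (*-congʳ (begin
    fallingFactorial (fromℤ (k ℤ.+ + m ℤ.- + 1)) m ≡⟨ ≡.cong (λ z → fallingFactorial (fromℤ z) m) index ⟩
    fallingFactorial (fromℕ i) m                   ≈⟨ fallingFactorial-vanishes i m i<m ⟩
    0#                                             ∎)) (zeroˡ _))) (zeroˡ _)
    where
    i : ℕ
    i = m ℕ.∸ suc ℤ.∣ k ∣
    m≡ : m ≡ suc ℤ.∣ k ∣ ℕ.+ i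
    m≡ = ≡.sym (ℕₚ.m+[n∸m]≡n ∣k∣<m)
    i<m : i ℕ.< m
    i<m = ≡.subst (i ℕ.<_) (≡.sym m≡) (s≤s (ℕₚ.m≤n+m i ℤ.∣ k ∣))
    k≡ : ∀ k → k ℤ.≤ + 0 → k ≡ ℤ.- + ℤ.∣ k ∣
    k≡ (+ zero)  _             = ≡.refl
    k≡ (+ suc n) (ℤ.+≤+ ())
    k≡ -[1+ n ]  _             = ≡.refl
    cancel : ∀ a i → ℤ.- a ℤ.+ (+ 1 ℤ.+ a ℤ.+ i) ℤ.- + 1 ≡ i
    cancel = ℤSolver.solve-∀
    index : k ℤ.+ + m ℤ.- + 1 ≡ + i
    index = ≡.trans (≡.cong₂ (λ z n → z ℤ.+ + n ℤ.- + 1) (k≡ k k≤0) m≡) (cancel (+ ℤ.∣ k ∣) (+ i))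

  -- `p` stands for n_{r-1} and `suc j` for the gap, that is, for the n_r of the theorem.
  negBinomTerm : ℤ → ℕ → ℕ → Series
  negBinomTerm k p j m = negBinom k m * (fromℕ p ^ m * suc j ^ℤ (ℤ.- k ℤ.- + m))

  negBinomTerm-vanishes : ∀ k p j m → k ℤ.≤ + 0 → suc ℤ.∣ k ∣ ℕ.≤ m → negBinomTerm k p j m ≈ 0#
  negBinomTerm-vanishes k p j m k≤0 ∣k∣<m = trans (*-congʳ (negBinom-vanishes k m k≤0 ∣k∣<m)) (zeroˡ _)

  -- As a series in z, the terms of index k expand (j + 1 + p z)^(-k).
  negBinomTerm-step : ∀ k p j →
    polynomial (fromℕ (suc j) ∷ fromℕ p ∷ []) *ₛ negBinomTerm (ℤ.suc k) p j ≋ negBinomTerm k p j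
  negBinomTerm-step k p j zero = begin
    J * (invFact₀ * (1# * suc j ^ℤ (ℤ.- ℤ.suc k ℤ.- + 0))) + 0# ≈⟨ +-identityʳ _ ⟩
    J * (invFact₀ * (1# * suc j ^ℤ (ℤ.- ℤ.suc k ℤ.- + 0)))      ≈⟨ solve 4 (λ J b o w → J :* (b :* (o :* w)) := b :* (o :* (J :* w))) refl _ _ _ _ ⟩
    invFact₀ * (1# * (J * suc j ^ℤ (ℤ.- ℤ.suc k ℤ.- + 0)))      ≈⟨ *-congˡ (*-congˡ (zpow-suc J (fromℕ#0 (suc j)) (ℤ.- ℤ.suc k ℤ.- + 0))) ⟨
    invFact₀ * (1# * suc j ^ℤ (ℤ.suc (ℤ.- ℤ.suc k ℤ.- + 0)))    ≡⟨ ≡.cong (λ z → invFact₀ * (1# * suc j ^ℤ z)) (index k) ⟩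
    invFact₀ * (1# * suc j ^ℤ (ℤ.- k ℤ.- + 0))                  ∎
    where
    J invFact₀ : Carrier
    J = fromℕ (suc j)
    invFact₀ = 1# * invFact 0 * 1#
    index : ∀ k → + 1 ℤ.+ (ℤ.- (+ 1 ℤ.+ k) ℤ.- + 0) ≡ ℤ.- k ℤ.- + 0
    index = ℤSolver.solve-∀
  negBinomTerm-step k p j (suc m) = begin
    J * negBinomTerm (ℤ.suc k) p j (suc m) + (Pz *ₛ negBinomTerm (ℤ.suc k) p j) m
      ≈⟨ +-congˡ (trans (+-congˡ (∑-zero m λ i _ → zeroˡ (negBinomTerm (ℤ.suc k) p j (m ℕ.∸ suc i)))) (+-identityʳ _)) ⟩
    J * (b₁ * (P * Pᵐ * suc j ^ℤ (ℤ.- ℤ.suc k ℤ.- + suc m))) + P * (b₀ * (Pᵐ * suc j ^ℤ (ℤ.- ℤ.suc k ℤ.- + m)))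
      ≡⟨ ≡.cong (λ z → J * (b₁ * (P * Pᵐ * suc j ^ℤ (ℤ.- ℤ.suc k ℤ.- + suc m))) + P * (b₀ * (Pᵐ * suc j ^ℤ z))) (index₀ k (+ m)) ⟩
    J * (b₁ * (P * Pᵐ * suc j ^ℤ (ℤ.- ℤ.suc k ℤ.- + suc m))) + P * (b₀ * (Pᵐ * w))
      -- The factor `J` raises the exponent of `suc j` by one, after which both terms carry the same
      -- power `w` and Pascal's rule can merge them.
      ≈⟨ +-congʳ (trans
           (solve 4 (λ J b q w → J :* (b :* (q :* w)) := b :* (q :* (J :* w))) refl _ _ _ _)
           (*-congˡ (*-congˡ (trans (sym (zpow-suc J (fromℕ#0 (suc j)) (ℤ.- ℤ.suc k ℤ.- + suc m))) (reflexive (≡.cong (suc j ^ℤ_) (index₁ k (+ m)))))))) ⟩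
    b₁ * (P * Pᵐ * w) + P * (b₀ * (Pᵐ * w))
      ≈⟨ solve 5 (λ b b′ P q w → b :* (P :* q :* w) :+ P :* (b′ :* (q :* w)) := (b :+ b′) :* (P :* q :* w)) refl b₁ b₀ P Pᵐ w ⟩
    (b₁ + b₀) * (P * Pᵐ * w)
      ≈⟨ *-congʳ (negBinom-Pascal k m) ⟨
    negBinomTerm k p j (suc m) ∎
    where
    J P Pᵐ w b₀ b₁ : Carrier
    J = fromℕ (suc j)
    P = fromℕ p
    Pᵐ = P ^ m
    w = suc j ^ℤ (ℤ.- k ℤ.- + suc m)
    b₀ = negBinom (ℤ.suc k) m
    b₁ = negBinom (ℤ.suc k) (suc m)
    Pz : Series
    Pz = polynomial (fromℕ p ∷ [])
    index₀ : ∀ k m → ℤ.- (+ 1 ℤ.+ k) ℤ.- m ≡ ℤ.- k ℤ.- (+ 1 ℤ.+ m)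
    index₀ = ℤSolver.solve-∀
    index₁ : ∀ k m → + 1 ℤ.+ (ℤ.- (+ 1 ℤ.+ k) ℤ.- (+ 1 ℤ.+ m)) ≡ ℤ.- k ℤ.- (+ 1 ℤ.+ m)
    index₁ = ℤSolver.solve-∀

  ℤ-induction : ∀ {ℓ} (P : ℤ → Set ℓ) → P (+ 0) → (∀ k → P k → P (ℤ.suc k)) → (∀ k → P (ℤ.suc k) → P k) → ∀ k → P k
  ℤ-induction P P0 up down (+ zero)     = P0
  ℤ-induction P P0 up down (+ suc n)    = up (+ n) (ℤ-induction P P0 up down (+ n))
  ℤ-induction P P0 up down -[1+ zero ]  = down -[1+ 0 ] P0
  ℤ-induction P P0 up down -[1+ suc n ] = down -[1+ suc n ] (ℤ-induction P P0 up down -[1+ n ])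

  -- Induction from `k = 0` in both directions along `negBinomTerm-step`: upwards it divides by
  -- `linear`, whose value `p + j + 1` at 1 is positive, and downwards it multiplies by it.
  negBinomTerm-sum : ∀ p j k → negBinomTerm k p j PositivelySumsTo suc (p ℕ.+ j) ^ℤ (ℤ.- k)
  negBinomTerm-sum p j = ℤ-induction (λ k → negBinomTerm k p j PositivelySumsTo suc (p ℕ.+ j) ^ℤ (ℤ.- k)) base
    (λ k sum → PositivelySumsTo-polynomial⁻¹* linear (<-respʳ-≈ (sym linearAt1) (0<1+n (p ℕ.+ j))) (negBinomTerm-step k p j)
      (PositivelySumsTo-cong (λ _ → refl) (sym (value k)) sum))
    (λ k sum → PositivelySumsTo-cong (λ _ → refl) (value k)
      (PositivelySumsTo-polynomial* linear (negBinomTerm-step k p j) sum))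
    where
    linear : List Carrier
    linear = fromℕ (suc j) ∷ fromℕ p ∷ []
    linearAt1 : polynomialAt1 linear ≈ fromℕ (suc (p ℕ.+ j))
    linearAt1 = begin
      fromℕ (suc j) + (fromℕ p + 0#) ≈⟨ +-congˡ (+-identityʳ _) ⟩
      fromℕ (suc j) + fromℕ p        ≈⟨ ·-homo-+ 1# (suc j) p ⟨
      fromℕ (suc (j ℕ.+ p))          ≡⟨ ≡.cong (λ n → fromℕ (suc n)) (ℕₚ.+-comm j p) ⟩
      fromℕ (suc (p ℕ.+ j))          ∎
    index : ∀ k → + 1 ℤ.+ ℤ.- (+ 1 ℤ.+ k) ≡ ℤ.- k
    index = ℤSolver.solve-∀
    value : ∀ k → polynomialAt1 linear * suc (p ℕ.+ j) ^ℤ (ℤ.- ℤ.suc k) ≈ suc (p ℕ.+ j) ^ℤ (ℤ.- k)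
    value k = trans (*-congʳ linearAt1) (trans (sym (zpow-suc _ (fromℕ#0 (suc (p ℕ.+ j))) (ℤ.- ℤ.suc k)))
      (reflexive (≡.cong (suc (p ℕ.+ j) ^ℤ_) (index k))))
    term₀≈1 : negBinomTerm (+ 0) p j 0 ≈ 1#
    term₀≈1 = trans (*-cong (trans (*-identityʳ _) (trans (*-identityˡ _) invFact-0)) (*-identityˡ 1#)) (*-identityˡ 1#)
    base : negBinomTerm (+ 0) p j PositivelySumsTo 1#
    base = FinitelySumsTo⇒PositivelySumsTo (1 ,
      (λ m → negBinomTerm-vanishes (+ 0) p j m (ℤ.+≤+ z≤n)) ,
      trans (+-identityʳ _) term₀≈1)

  -- Multiple polylogarithms and Stirling numbers

  -- Vectors are functions, and changing the last entry preserves `init` only pointwise.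
  Li-cong : ∀ s {k k′} → k ≗ k′ → Li s k ≋ Li s k′
  Li-cong zero    k≗k′ N       = refl
  Li-cong (suc s) k≗k′ zero    = refl
  Li-cong (suc s) k≗k′ (suc N) = *-cong
    (reflexive (≡.cong (λ z → suc N ^ℤ (ℤ.- z)) (k≗k′ (Fin.fromℕ s))))
    (∑-cong (suc N) (Li-cong s λ i → k≗k′ (Fin.inject₁ i)))

  Li-order : ∀ s k N → N ℕ.< s → Li s k N ≈ 0#
  Li-order (suc s) k zero    _         = refl
  Li-order (suc s) k (suc N) (s≤s N<s) =
    trans (*-congˡ (∑-zero (suc N) λ i i<1+N → Li-order s (init k) i (ℕₚ.<-≤-trans i<1+N N<s))) (zeroʳ _)

  -- `p` is the outermost summation variable. This is how the powers `pᵐ` of the expansion turn into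
  -- the index k_{r-1} - m.
  Li-lowerLast : ∀ s k m p → Li (suc s) (updateAt k (Fin.fromℕ s) (ℤ._- + m)) p ≈ fromℕ p ^ m * Li (suc s) k p
  Li-lowerLast s k m zero    = sym (zeroʳ _)
  Li-lowerLast s k m (suc p) = begin
    suc p ^ℤ (ℤ.- last k′) * ∑< (suc p) (Li s (init k′))
      ≈⟨ *-cong (reflexive (≡.cong (suc p ^ℤ_) exponent)) (∑-cong (suc p) (Li-cong s init≗)) ⟩
    suc p ^ℤ (+ m ℤ.+ ℤ.- last k) * ∑< (suc p) (Li s (init k))
      ≈⟨ *-congʳ (zpow-+ _ (fromℕ#0 (suc p)) m (ℤ.- last k)) ⟩
    fromℕ (suc p) ^ m * suc p ^ℤ (ℤ.- last k) * ∑< (suc p) (Li s (init k))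
      ≈⟨ *-assoc _ _ _ ⟩
    fromℕ (suc p) ^ m * (suc p ^ℤ (ℤ.- last k) * ∑< (suc p) (Li s (init k))) ∎
    where
    k′ : Vector ℤ (suc s)
    k′ = updateAt k (Fin.fromℕ s) (ℤ._- + m)
    neg : ∀ a m → ℤ.- (a ℤ.- m) ≡ m ℤ.+ ℤ.- a
    neg = ℤSolver.solve-∀
    exponent : ℤ.- last k′ ≡ + m ℤ.+ ℤ.- last k
    exponent = ≡.trans (≡.cong ℤ.-_ (updateAt-updates (Fin.fromℕ s) k)) (neg (last k) (+ m))
    init≗ : init k′ ≗ init k
    init≗ i = updateAt-minimal (Fin.inject₁ i) (Fin.fromℕ s) k λ eq → Finₚ.fromℕ≢inject₁ (≡.sym eq)

  1^n≈1 : ∀ n → 1# ^ n ≈ 1#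
  1^n≈1 zero    = refl
  1^n≈1 (suc n) = trans (*-identityˡ _) (1^n≈1 n)

  -1*-1≈1 : - 1# * - 1# ≈ 1#
  -1*-1≈1 = trans (-1*x≈-x (- 1#)) (-‿involutive 1#)

  -1^n*-1^n≈1 : ∀ n → (- 1#) ^ n * (- 1#) ^ n ≈ 1#
  -1^n*-1^n≈1 zero    = *-identityˡ 1#
  -1^n*-1^n≈1 (suc n) = trans (*-interchange _ _ _ _) (trans (*-cong -1*-1≈1 (-1^n*-1^n≈1 n)) (*-identityˡ 1#))

  -- The exponent may be negative; inserting the square of (-1)^(j+1), which is 1, brings it to `l`.
  -1^[l-j-1] : ∀ l j → -1^ (+ l ℤ.- + j ℤ.- + 1) ≈ (- 1#) ^ j * (- 1#) ^ suc l
  -1^[l-j-1] l j = begin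
    w                                          ≈⟨ *-identityˡ w ⟨
    1# * w                                     ≈⟨ *-congʳ (-1^n*-1^n≈1 (suc j)) ⟨
    (- 1#) ^ suc j * (- 1#) ^ suc j * w        ≈⟨ *-assoc _ _ w ⟩
    (- 1#) ^ suc j * ((- 1#) ^ suc j * w)      ≈⟨ *-congˡ (zpow-+ (- 1#) -1#0 (suc j) (+ l ℤ.- + j ℤ.- + 1)) ⟨
    (- 1#) ^ suc j * -1^ (+ suc j ℤ.+ (+ l ℤ.- + j ℤ.- + 1)) ≡⟨ ≡.cong (λ z → (- 1#) ^ suc j * -1^ z) (cancel (+ j) (+ l)) ⟩
    - 1# * (- 1#) ^ j * (- 1#) ^ l             ≈⟨ solve 3 (λ n a b → n :* a :* b := a :* (n :* b)) refl (- 1#) _ _ ⟩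
    (- 1#) ^ j * (- 1#) ^ suc l                ∎
    where
    w : Carrier
    w = -1^ (+ l ℤ.- + j ℤ.- + 1)
    cancel : ∀ j l → (+ 1 ℤ.+ j) ℤ.+ (l ℤ.- j ℤ.- + 1) ≡ l
    cancel = ℤSolver.solve-∀

  1-e⁻ᵗ-0 : 1-e⁻ᵗ 0 ≈ 0#
  1-e⁻ᵗ-0 = trans (+-congˡ (-‿cong (trans (*-identityˡ _) invFact-0))) (-‿inverseʳ 1#)

  -- 1 - e⁻ᵗ arises from -(eᵗ - 1) by the substitution of -t for t: each of the `j` factors
  -- contributes a sign, and the substitution contributes (-1)ⁿ.
  1-e⁻ᵗ-^ₛ : ∀ j n → (1-e⁻ᵗ ^ₛ j) n ≈ (- 1#) ^ j * ((- 1#) ^ n * ((expₛ 1# -ₛ 1ₛ) ^ₛ j) n)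
  1-e⁻ᵗ-^ₛ zero    zero    = sym (trans (*-identityˡ _) (*-identityˡ _))
  1-e⁻ᵗ-^ₛ zero    (suc n) = sym (trans (*-congˡ (zeroʳ _)) (zeroʳ _))
  1-e⁻ᵗ-^ₛ (suc j) n = begin
    ∑< (suc n) (λ i → 1-e⁻ᵗ i * (1-e⁻ᵗ ^ₛ j) (n ℕ.∸ i))
      ≈⟨ ∑-cong< (suc n) (λ i i<1+n → trans (*-cong (linear i) (1-e⁻ᵗ-^ₛ j (n ℕ.∸ i))) (trans
           (solve 6 (λ o e a f e′ b → (o :* (e :* a)) :* (f :* (e′ :* b)) := (o :* f) :* ((e :* e′) :* (a :* b))) refl
             (- 1#) ((- 1#) ^ i) (v i) ((- 1#) ^ j) ((- 1#) ^ (n ℕ.∸ i)) ((v ^ₛ j) (n ℕ.∸ i)))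
           (*-congˡ (*-congʳ (trans (sym (^-homo-* (- 1#) i (n ℕ.∸ i)))
             (reflexive (≡.cong ((- 1#) ^_) (ℕₚ.m+[n∸m]≡n (ℕₚ.≤-pred i<1+n))))))))) ⟩
    ∑< (suc n) (λ i → (- 1#) ^ suc j * ((- 1#) ^ n * (v i * (v ^ₛ j) (n ℕ.∸ i))))
      ≈⟨ trans (∑-*ˡ (suc n) ((- 1#) ^ suc j) (λ i → (- 1#) ^ n * (v i * (v ^ₛ j) (n ℕ.∸ i))))
           (*-congˡ (∑-*ˡ (suc n) ((- 1#) ^ n) (λ i → v i * (v ^ₛ j) (n ℕ.∸ i)))) ⟩
    (- 1#) ^ suc j * ((- 1#) ^ n * (v ^ₛ suc j) n) ∎
    where
    v : Series
    v = expₛ 1# -ₛ 1ₛ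
    e*1ₛ : ∀ n → (- 1#) ^ n * 1ₛ n ≈ 1ₛ n
    e*1ₛ zero    = *-identityˡ 1#
    e*1ₛ (suc n) = zeroʳ _
    linear : ∀ n → 1-e⁻ᵗ n ≈ - 1# * ((- 1#) ^ n * v n)
    linear n = sym (begin
      - 1# * ((- 1#) ^ n * (1# ^ n * invFact n - 1ₛ n))
        ≈⟨ -1*x≈-x _ ⟩
      - ((- 1#) ^ n * (1# ^ n * invFact n - 1ₛ n))
        ≈⟨ -‿cong (trans (x[y-z]≈xy-xz _ _ _) (+-cong (*-congˡ (trans (*-congʳ (1^n≈1 n)) (*-identityˡ _))) (-‿cong (e*1ₛ n)))) ⟩
      - ((- 1#) ^ n * invFact n - 1ₛ n)
        ≈⟨ -‿anti-homo-- _ _ ⟩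
      1ₛ n - (- 1#) ^ n * invFact n ∎)

  -- The Stirling factor of the theorem is the coefficient of tˡ/l! in uʲ/t: the division by t
  -- shifts the index, and 1/(l + 1) turns (l + 1)! into l!.
  S₂-1-e⁻ᵗ : ∀ l j → fromℕ (j !) * -1^ (+ l ℤ.- + j ℤ.- + 1) * S₂ (suc l) j * 1/ suc l ≈ fromℕ (l !) * (1-e⁻ᵗ ^ₛ j) (suc l)
  S₂-1-e⁻ᵗ l j = begin
    fromℕ (j !) * w * (fromℕ (suc l !) * (invFact j * V)) * 1/ suc l
      ≈⟨ *-congʳ (*-congˡ (*-congʳ (fromℕ-* (suc l) (l !)))) ⟩
    fromℕ (j !) * w * (fromℕ (suc l) * fromℕ (l !) * (invFact j * V)) * 1/ suc l
      ≈⟨ solve 7 (λ a w b f i v c → a :* w :* (b :* f :* (i :* v)) :* c := (a :* i) :* ((b :* c) :* (f :* (w :* v)))) refl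
           (fromℕ (j !)) w (fromℕ (suc l)) (fromℕ (l !)) (invFact j) V (1/ suc l) ⟩
    fromℕ (j !) * invFact j * (fromℕ (suc l) * 1/ suc l * (fromℕ (l !) * (w * V)))
      ≈⟨ trans (*-cong (recip-inverse _ _) (trans (*-congʳ (recip-inverse _ _)) (*-identityˡ _))) (*-identityˡ _) ⟩
    fromℕ (l !) * (w * V)
      ≈⟨ *-congˡ (trans (*-congʳ (-1^[l-j-1] l j)) (*-assoc _ _ V)) ⟩
    fromℕ (l !) * ((- 1#) ^ j * ((- 1#) ^ suc l * V))
      ≈⟨ *-congˡ (1-e⁻ᵗ-^ₛ j (suc l)) ⟨
    fromℕ (l !) * (1-e⁻ᵗ ^ₛ j) (suc l) ∎
    where
    w V : Carrier
    w = -1^ (+ l ℤ.- + j ℤ.- + 1)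
    V = ((expₛ 1# -ₛ 1ₛ) ^ₛ j) (suc l)

  fromℕ-C : ∀ {n k} → k ℕ.≤ n → fromℕ (n C k) * (fromℕ (k !) * fromℕ ((n ℕ.∸ k) !)) ≈ fromℕ (n !)
  fromℕ-C {n} {k} k≤n = begin
    fromℕ (n C k) * (fromℕ (k !) * fromℕ ((n ℕ.∸ k) !)) ≈⟨ *-congˡ (fromℕ-* (k !) ((n ℕ.∸ k) !)) ⟨
    fromℕ (n C k) * fromℕ (k ! ℕ.* (n ℕ.∸ k) !)         ≈⟨ fromℕ-* (n C k) _ ⟨
    fromℕ ((n C k) ℕ.* (k ! ℕ.* (n ℕ.∸ k) !))           ≡⟨ ≡.cong fromℕ (≡.trans
                                                             (≡.cong (ℕ._* (k ! ℕ.* (n ℕ.∸ k) !)) (nCk≡n!/k![n-k]! k≤n))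
                                                             (m/n*n≡m {{ℕₚ._!*_!≢0 k (n ℕ.∸ k)}} (k![n∸k]!∣n! k≤n))) ⟩
    fromℕ (n !)                                         ∎

  -- Degenerate multi-poly-Bernoulli numbers

  module MultiPolyBernoulli (lam : Carrier) (lam≠0 : lam # 0#) (x : Carrier) where

    E h B : Series
    E = degExp lam lam≠0 x
    h = inverseₛ (shift 1 (degExp-1 lam lam≠0))
    B = quotient tₛ (degExp-1 lam lam≠0) 1

    -- h = t / (e_λ(t) - 1), and W s p = (1 - e⁻ᵗ)ᵖ e_λˣ(t) / (e_λ(t) - 1)ˢ provided that s ≤ p:
    -- otherwise the shift drops terms of the numerator.
    U : ℕ → Series
    U j = shift 1 (1-e⁻ᵗ ^ₛ suc j)

    W : ℕ → ℕ → Series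
    W s p = shift s (1-e⁻ᵗ ^ₛ p *ₛ E) *ₛ h ^ₛ s

    -- Truncating the composite with 1 - e⁻ᵗ at any M > s + q makes the dependence of
    -- the numbers on the coefficients of Li a finite linear combination.
    degMultiPolyBernoulli-∑ : ∀ s k q M → s ℕ.+ q ℕ.< M →
      degMultiPolyBernoulli lam lam≠0 s k q x ≈ fromℕ (q !) * ∑< M (λ p → fromℕ (s !) * Li s k p * W s p q)
    degMultiPolyBernoulli-∑ s k q M s+q<M = *-congˡ
      (*ₛ-∑ˡ q M φ (λ p → shift s (1-e⁻ᵗ ^ₛ p *ₛ E)) (h ^ₛ s) λ i i≤q →
        *ₛ-∑ˡ (s ℕ.+ i) M φ (1-e⁻ᵗ ^ₛ_) E λ a a≤s+i → begin
          fromℕ (s !) * compose (Li s k) 1-e⁻ᵗ a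
            ≈⟨ *-congˡ (compose-∑ (Li s k) {1-e⁻ᵗ} 1-e⁻ᵗ-0 (ℕₚ.≤-<-trans (ℕₚ.≤-trans a≤s+i (ℕₚ.+-monoʳ-≤ s i≤q)) s+q<M)) ⟩
          fromℕ (s !) * ∑< M (λ p → Li s k p * (1-e⁻ᵗ ^ₛ p) a)
            ≈⟨ ∑-*ˡ M (fromℕ (s !)) (λ p → Li s k p * (1-e⁻ᵗ ^ₛ p) a) ⟨
          ∑< M (λ p → fromℕ (s !) * (Li s k p * (1-e⁻ᵗ ^ₛ p) a))
            ≈⟨ ∑-cong M (λ p → sym (*-assoc (fromℕ (s !)) (Li s k p) ((1-e⁻ᵗ ^ₛ p) a))) ⟩
          ∑< M (λ p → φ p * (1-e⁻ᵗ ^ₛ p) a) ∎)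
      where
      φ : ℕ → Carrier
      φ p = fromℕ (s !) * Li s k p

    -- The numerator has order at least `p`, and division by `tˢ` leaves more than `q`.
    W-vanishes : ∀ s p q → s ℕ.+ q ℕ.< p → W s p q ≈ 0#
    W-vanishes s p q s+q<p = *ₛ-zeroˡ q (h ^ₛ s) λ i i≤q → *ₛ-zeroˡ (s ℕ.+ i) E λ a a≤s+i →
      ^ₛ-order {1-e⁻ᵗ} 1-e⁻ᵗ-0 p a (ℕₚ.≤-<-trans (ℕₚ.≤-trans a≤s+i (ℕₚ.+-monoʳ-≤ s i≤q)) s+q<p)

    B≋h : B ≋ h
    -- `shift 1 tₛ` computes to `1ₛ`, and `h ^ₛ 1` to `h *ₛ 1ₛ`.
    B≋h n = trans (*ₛ-identityˡ (h *ₛ 1ₛ) n) (*ₛ-identityʳ h n)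

    -- The factor `B` = t/d supplies one more power of 1/d, and its t cancels the 1/t of `U j`.
    W-step : ∀ s p j → s ℕ.≤ p →
      (U j *ₛ W s p) *ₛ B ≋ W (suc s) (suc (p ℕ.+ j))
    W-step s p j s≤p n = begin
      ((U j *ₛ (G *ₛ h ^ₛ s)) *ₛ B) n        ≈⟨ *ₛ-congˡ (U j *ₛ (G *ₛ h ^ₛ s)) B≋h n ⟩
      ((U j *ₛ (G *ₛ h ^ₛ s)) *ₛ h) n        ≈⟨ *ₛ-congʳ h (*ₛ-assoc (U j) G (h ^ₛ s)) n ⟨
      (((U j *ₛ G) *ₛ h ^ₛ s) *ₛ h) n        ≈⟨ *ₛ-assoc (U j *ₛ G) (h ^ₛ s) h n ⟩
      ((U j *ₛ G) *ₛ (h ^ₛ s *ₛ h)) n        ≈⟨ *ₛ-congˡ (U j *ₛ G) (*ₛ-comm (h ^ₛ s) h) n ⟩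
      ((U j *ₛ G) *ₛ h ^ₛ suc s) n           ≈⟨ *ₛ-congʳ (h ^ₛ suc s) numerator n ⟩
      W (suc s) (suc (p ℕ.+ j)) n          ∎
      where
      u : Series
      u = 1-e⁻ᵗ
      G : Series
      G = shift s (u ^ₛ p *ₛ E)
      order : ∀ i → i ℕ.< s → (u ^ₛ p *ₛ E) i ≈ 0#
      order i i<s = *ₛ-zeroˡ i E λ a a≤i → ^ₛ-order {u} 1-e⁻ᵗ-0 p a (ℕₚ.≤-<-trans a≤i (ℕₚ.<-≤-trans i<s s≤p))
      numerator : U j *ₛ G ≋ shift (suc s) (u ^ₛ suc (p ℕ.+ j) *ₛ E)
      numerator i = begin
        (U j *ₛ G) i
          ≈⟨ *ₛ-shift s (U j) {u ^ₛ p *ₛ E} order i ⟨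
        (U j *ₛ (u ^ₛ p *ₛ E)) (s ℕ.+ i)
          ≈⟨ shift1-*ₛ {u ^ₛ suc j} (u ^ₛ p *ₛ E) (^ₛ-order {u} 1-e⁻ᵗ-0 (suc j) 0 (s≤s z≤n)) (s ℕ.+ i) ⟨
        (u ^ₛ suc j *ₛ (u ^ₛ p *ₛ E)) (suc (s ℕ.+ i))
          ≈⟨ *ₛ-assoc (u ^ₛ suc j) (u ^ₛ p) E (suc (s ℕ.+ i)) ⟨
        ((u ^ₛ suc j *ₛ u ^ₛ p) *ₛ E) (suc (s ℕ.+ i))
          ≈⟨ *ₛ-congʳ E (^ₛ-homo-*ₛ u (suc j) p) (suc (s ℕ.+ i)) ⟨
        (u ^ₛ (suc j ℕ.+ p) *ₛ E) (suc (s ℕ.+ i))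
          ≡⟨ ≡.cong (λ N → (u ^ₛ suc N *ₛ E) (suc (s ℕ.+ i))) (ℕₚ.+-comm j p) ⟩
        (u ^ₛ suc (p ℕ.+ j) *ₛ E) (suc (s ℕ.+ i)) ∎

    -- From r indices to r - 1 in a fixed degree n

    module Reduction (r-2 : ℕ) (k⃗ : Vector ℤ (suc (suc r-2))) (n : ℕ) where

      -- Only powers of 1 - e⁻ᵗ up to `r + n` reach tⁿ after division by tʳ. Hence `M` bounds the
      -- last polylogarithm index, and with it both n_{r-1} and the gap.
      r s M : ℕ
      r = suc (suc r-2)
      s = suc r-2
      M = r ℕ.+ n

      kᵣ : ℤ
      kᵣ = last k⃗

      L : Series
      L = Li s (init k⃗)

      β : ℕ → Carrier
      β = degBernoulli lam lam≠0

      stirling : ℕ → ℕ → Carrier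
      stirling l j = fromℕ (suc j !) * -1^ (+ l ℤ.- + suc j ℤ.- + 1) * S₂ (suc l) (suc j) * 1/ suc l

      summand : ℕ → ℕ → ℕ → ℕ → Carrier
      summand k l j m =
        binom (fromℤ (kᵣ ℤ.+ + m ℤ.- + 1)) m * fromℕ (k C l) * fromℕ (n C k) * (- 1#) ^ m
          * stirling l j
          * suc j ^ℤ (ℤ.- kᵣ ℤ.- + m)
          * β (n ℕ.∸ k)
          * degMultiPolyBernoulli lam lam≠0 s (updateAt (init k⃗) (Fin.fromℕ r-2) (ℤ._- + m)) (k ℕ.∸ l) x

      -- The share of n_{r-1} = `p` in the summand, stripped of everything that depends on `m`; the
      -- rest is `negBinomTerm`.
      weight : ℕ → ℕ → ℕ → ℕ → Carrier
      weight k l j p = fromℕ (k C l) * fromℕ (n C k) * stirling l j * β (n ℕ.∸ k)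
        * (fromℕ ((k ℕ.∸ l) !) * (fromℕ (s !) * L p * W s p (k ℕ.∸ l)))

      z : ℕ → Carrier
      z N = suc N ^ℤ (ℤ.- kᵣ)

      Σₘ : ℕ → ℕ → ℕ → Carrier
      Σₘ k l j = ∑< M λ p → weight k l j p * z (p ℕ.+ j)

      -- The range of `p` is the same for all `m`, so the series in `m` is a finite combination of
      -- negative binomial series.
      summand-∑ : ∀ k l j → k ℕ.≤ n → summand k l j ≋ λ m → ∑< M λ p → weight k l j p * negBinomTerm kᵣ p j m
      summand-∑ k l j k≤n m = begin
        bn * K₁ * K₂ * e * D * y * b * degMultiPolyBernoulli lam lam≠0 s k′ q x
          ≈⟨ *-congˡ (degMultiPolyBernoulli-∑ s k′ q M (s≤s (ℕₚ.+-monoʳ-≤ s q≤n))) ⟩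
        bn * K₁ * K₂ * e * D * y * b * (Q * ∑< M (λ p → S * Li s k′ p * W s p q))
          ≈⟨ *-congˡ (sym (∑-*ˡ M Q (λ p → S * Li s k′ p * W s p q))) ⟩
        bn * K₁ * K₂ * e * D * y * b * ∑< M (λ p → Q * (S * Li s k′ p * W s p q))
          ≈⟨ ∑-*ˡ M (bn * K₁ * K₂ * e * D * y * b) (λ p → Q * (S * Li s k′ p * W s p q)) ⟨
        ∑< M (λ p → bn * K₁ * K₂ * e * D * y * b * (Q * (S * Li s k′ p * W s p q)))
          ≈⟨ ∑-cong M (λ p → trans
               (*-congˡ (*-congˡ (*-congʳ (*-congˡ (Li-lowerLast r-2 (init k⃗) m p)))))
               (solve 12 (λ bn K₁ K₂ e D y b Q S P L w →
                   bn :* K₁ :* K₂ :* e :* D :* y :* b :* (Q :* (S :* (P :* L) :* w)) :=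
                   (K₁ :* K₂ :* D :* b :* (Q :* (S :* L :* w))) :* (bn :* e :* (P :* y))) refl
                 bn K₁ K₂ e D y b Q S (fromℕ p ^ m) (L p) (W s p q))) ⟩
        ∑< M (λ p → weight k l j p * negBinomTerm kᵣ p j m) ∎
        where
        q : ℕ
        q = k ℕ.∸ l
        q≤n : q ℕ.≤ n
        q≤n = ℕₚ.≤-trans (ℕₚ.m∸n≤m k l) k≤n
        k′ : Vector ℤ s
        k′ = updateAt (init k⃗) (Fin.fromℕ r-2) (ℤ._- + m)
        bn K₁ K₂ e D y b Q S : Carrier
        bn = binom (fromℤ (kᵣ ℤ.+ + m ℤ.- + 1)) m
        K₁ = fromℕ (k C l)
        K₂ = fromℕ (n C k)
        e = (- 1#) ^ m
        D = stirling l j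
        y = suc j ^ℤ (ℤ.- kᵣ ℤ.- + m)
        b = β (n ℕ.∸ k)
        Q = fromℕ (q !)
        S = fromℕ (s !)

      summand-SumsTo : ∀ k l j → k ℕ.≤ n → summand k l j SumsTo Σₘ k l j
      summand-SumsTo k l j k≤n = PositivelySumsTo⇒SumsTo (PositivelySumsTo-cong
        (λ m → sym (summand-∑ k l j k≤n m)) refl
        (PositivelySumsTo-∑ M (λ p → weight k l j p ∙ₛ negBinomTerm kᵣ p j)
          λ p → PositivelySumsTo-∙ (weight k l j p) (negBinomTerm-sum p j kᵣ)))

      -- For `kᵣ ≤ 0` the series terminates. Its finite sum is also a sum in the sense of
      -- `_SumsTo_`, so uniqueness identifies it with `Σₘ`.
      summand-ConvergesTo : ∀ k l j → k ℕ.≤ n → kᵣ ℤ.≤ + 0 → summand k l j ConvergesTo Σₘ k l j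
      summand-ConvergesTo k l j k≤n kᵣ≤0 = FinitelySumsTo⇒ConvergesTo (FinitelySumsTo-cong (λ _ → refl)
        (SumsTo-unique (PositivelySumsTo⇒SumsTo (FinitelySumsTo⇒PositivelySumsTo finite)) (summand-SumsTo k l j k≤n))
        finite)
        where
        finite : summand k l j FinitelySumsTo ∑< (suc ℤ.∣ kᵣ ∣) (summand k l j)
        finite = suc ℤ.∣ kᵣ ∣ , (λ m ∣kᵣ∣<m → trans (summand-∑ k l j k≤n m) (∑-zero M λ p _ →
          trans (*-congˡ (negBinomTerm-vanishes kᵣ p j m kᵣ≤0 ∣kᵣ∣<m)) (zeroʳ (weight k l j p)))) , refl

      -- Up to the factor (r-1)!, the contribution of n_{r-1} = `p` and last index `p + j + 1` to
      -- the coefficient of the polylogarithm with r indices.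
      g : ℕ → ℕ → Carrier
      g p j = fromℕ (s !) * L p * z (p ℕ.+ j)

      H : ℕ → ℕ → ℕ → ℕ → Carrier
      H k l j p = g p j * (U j l * W s p (k ℕ.∸ l) * B (n ℕ.∸ k))

      -- The two binomial coefficients and the factorials of the three exponential coefficients
      -- collapse to n!, leaving ordinary coefficients in degrees `l`, `k - l` and `n - k`.
      weight-z : ∀ k l j p → k ℕ.≤ n → l ℕ.≤ k →
        weight k l j p * z (p ℕ.+ j) ≈ fromℕ (n !) * H k l j p
      weight-z k l j p k≤n l≤k = begin
        K₁ * K₂ * stirling l j * (N′ * b) * (Q * (S * L p * w)) * ζ
          ≈⟨ *-congʳ (*-congʳ (*-congʳ (*-congˡ (S₂-1-e⁻ᵗ l (suc j))))) ⟩
        K₁ * K₂ * (F * a) * (N′ * b) * (Q * (S * L p * w)) * ζ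
          ≈⟨ solve 11 (λ K₁ K₂ F a N b Q S L w ζ →
               K₁ :* K₂ :* (F :* a) :* (N :* b) :* (Q :* (S :* L :* w)) :* ζ :=
               (K₂ :* ((K₁ :* (F :* Q)) :* N)) :* (S :* L :* ζ :* (a :* w :* b))) refl
               K₁ K₂ F a N′ b Q S (L p) w ζ ⟩
        K₂ * (K₁ * (F * Q) * N′) * (S * L p * ζ * (a * w * b))
          ≈⟨ *-congʳ (trans (*-congˡ (*-congʳ (fromℕ-C l≤k))) (fromℕ-C k≤n)) ⟩
        fromℕ (n !) * (S * L p * ζ * (a * w * b)) ∎
        where
        K₁ K₂ F a N′ b Q S w ζ : Carrier
        K₁ = fromℕ (k C l)
        K₂ = fromℕ (n C k)
        F = fromℕ (l !)
        a = U j l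
        N′ = fromℕ ((n ℕ.∸ k) !)
        b = B (n ℕ.∸ k)
        Q = fromℕ ((k ℕ.∸ l) !)
        S = fromℕ (s !)
        w = W s p (k ℕ.∸ l)
        ζ = z (p ℕ.+ j)

      -- `U j` has order at least `j`; this is why the sum over n_r in the theorem stops at l + 1.
      H-vanishes : ∀ k l j p → l ℕ.< j → H k l j p ≈ 0#
      H-vanishes k l j p l<j = begin
        g p j * (U j l * W s p (k ℕ.∸ l) * B (n ℕ.∸ k))
          ≈⟨ *-congˡ (*-congʳ (*-congʳ (^ₛ-order {1-e⁻ᵗ} 1-e⁻ᵗ-0 (suc j) (suc l) (s≤s l<j)))) ⟩
        g p j * (0# * W s p (k ℕ.∸ l) * B (n ℕ.∸ k))
          ≈⟨ *-congˡ (trans (*-congʳ (zeroˡ _)) (zeroˡ _)) ⟩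
        g p j * 0#
          ≈⟨ zeroʳ _ ⟩
        0# ∎

      Σₘ-H : ∀ k l → k ℕ.≤ n → l ℕ.≤ k →
        ∑< (suc l) (Σₘ k l) ≈ fromℕ (n !) * ∑< M (λ j → ∑< M (H k l j))
      Σₘ-H k l k≤n l≤k = begin
        ∑< (suc l) (λ j → ∑< M λ p → weight k l j p * z (p ℕ.+ j))
          ≈⟨ ∑-cong (suc l) (λ j → trans (∑-cong M λ p → weight-z k l j p k≤n l≤k) (∑-*ˡ M (fromℕ (n !)) (H k l j))) ⟩
        ∑< (suc l) (λ j → fromℕ (n !) * ∑< M (H k l j))
          ≈⟨ ∑-*ˡ (suc l) (fromℕ (n !)) (λ j → ∑< M (H k l j)) ⟩
        fromℕ (n !) * ∑< (suc l) (λ j → ∑< M (H k l j))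
          -- The range of `j` becomes independent of `l`, as the exchange of the sums requires.
          ≈⟨ *-congˡ (∑-extend (λ j → ∑< M (H k l j)) l<M λ j l<j → ∑-zero M λ p _ → H-vanishes k l j p l<j) ⟩
        fromℕ (n !) * ∑< M (λ j → ∑< M (H k l j)) ∎
        where
        l<M : suc l ℕ.≤ M
        l<M = s≤s (ℕₚ.≤-trans l≤k (ℕₚ.≤-trans k≤n (ℕₚ.m≤n+m n s)))

      T : ℕ → Carrier
      T N = W r N n

      -- The sums over `l` and `k` are the two Cauchy products in `W-step`.
      H-T : ∀ j p → ∑< (suc n) (λ k → ∑< (suc k) λ l → H k l j p) ≈ g p j * T (suc (p ℕ.+ j))
      H-T j p = begin
        ∑< (suc n) (λ k → ∑< (suc k) λ l → H k l j p)
          ≈⟨ ∑-cong (suc n) (λ k → trans (∑-*ˡ (suc k) (g p j) (λ l → U j l * W s p (k ℕ.∸ l) * B (n ℕ.∸ k)))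
               (*-congˡ (∑-*ʳ (suc k) (B (n ℕ.∸ k)) (λ l → U j l * W s p (k ℕ.∸ l))))) ⟩
        ∑< (suc n) (λ k → g p j * ((U j *ₛ W s p) k * B (n ℕ.∸ k)))
          ≈⟨ ∑-*ˡ (suc n) (g p j) (λ k → (U j *ₛ W s p) k * B (n ℕ.∸ k)) ⟩
        g p j * ((U j *ₛ W s p) *ₛ B) n
          ≈⟨ step (ℕₚ.≤-<-connex s p) ⟩
        g p j * T (suc (p ℕ.+ j)) ∎
        where
        g≈0 : p ℕ.< s → g p j ≈ 0#
        g≈0 p<s = trans (*-congʳ (trans (*-congˡ (Li-order s (init k⃗) p p<s)) (zeroʳ _))) (zeroˡ _)
        step : (s ℕ.≤ p) ⊎ (p ℕ.< s) → g p j * ((U j *ₛ W s p) *ₛ B) n ≈ g p j * T (suc (p ℕ.+ j))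
        step (inj₁ s≤p) = *-congˡ (W-step s p j s≤p n)
        -- Both sides are 0, since there is no chain 0 < n₁ < ⋯ < n_{r-1} = `p`.
        step (inj₂ p<s) = trans (trans (*-congʳ (g≈0 p<s)) (zeroˡ _)) (sym (trans (*-congʳ (g≈0 p<s)) (zeroˡ _)))

      ∑-Σₘ : ∑< (suc n) (λ k → ∑< (suc k) λ l → ∑< (suc l) λ j → Σₘ k l j) ≈
             fromℕ (n !) * ∑< M (λ p → ∑< M λ j → g p j * T (suc (p ℕ.+ j)))
      ∑-Σₘ = begin
        ∑< (suc n) (λ k → ∑< (suc k) λ l → ∑< (suc l) (Σₘ k l))
          ≈⟨ ∑-cong< (suc n) (λ k k<1+n → trans
               (∑-cong< (suc k) λ l l<1+k → Σₘ-H k l (ℕₚ.≤-pred k<1+n) (ℕₚ.≤-pred l<1+k))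
               (trans (∑-*ˡ (suc k) (fromℕ (n !)) (λ l → ∑< M λ j → ∑< M (H k l j)))
                 (*-congˡ (∑-swap₃ (suc k) M M (H k))))) ⟩
        ∑< (suc n) (λ k → fromℕ (n !) * ∑< M λ j → ∑< M λ p → ∑< (suc k) λ l → H k l j p)
          ≈⟨ ∑-*ˡ (suc n) (fromℕ (n !)) (λ k → ∑< M λ j → ∑< M λ p → ∑< (suc k) λ l → H k l j p) ⟩
        fromℕ (n !) * ∑< (suc n) (λ k → ∑< M λ j → ∑< M λ p → ∑< (suc k) λ l → H k l j p)
          ≈⟨ *-congˡ (∑-swap₃ (suc n) M M (λ k j p → ∑< (suc k) λ l → H k l j p)) ⟩
        fromℕ (n !) * ∑< M (λ j → ∑< M λ p → ∑< (suc n) λ k → ∑< (suc k) λ l → H k l j p)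
          ≈⟨ *-congˡ (∑-cong M λ j → ∑-cong M λ p → H-T j p) ⟩
        fromℕ (n !) * ∑< M (λ j → ∑< M λ p → g p j * T (suc (p ℕ.+ j)))
          ≈⟨ *-congˡ (∑-swap M M (λ j p → g p j * T (suc (p ℕ.+ j)))) ⟩
        fromℕ (n !) * ∑< M (λ p → ∑< M λ j → g p j * T (suc (p ℕ.+ j))) ∎

      -- The last index is N + 1 = p + (j + 1) with p = n_{r-1}, and r! = r (r-1)! yields the
      -- leading factor of the theorem.
      ∑-Li-T : ∑< (suc M) (λ N → fromℕ (r !) * Li r k⃗ N * T N) ≈
               fromℕ r * ∑< M (λ p → ∑< M λ j → g p j * T (suc (p ℕ.+ j)))
      ∑-Li-T = begin
        fromℕ (r !) * 0# * T 0 + ∑< M (λ N → fromℕ (r !) * (z N * ∑< (suc N) L) * T (suc N))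
          ≈⟨ trans (+-congʳ (trans (*-congʳ (zeroʳ _)) (zeroˡ _))) (+-identityˡ _) ⟩
        ∑< M (λ N → fromℕ (r !) * (z N * ∑< (suc N) L) * T (suc N))
          ≈⟨ ∑-cong M diagonal ⟩
        ∑< M (λ N → fromℕ r * ∑< (suc N) λ p → F p (N ℕ.∸ p))
          ≈⟨ ∑-*ˡ M (fromℕ r) (λ N → ∑< (suc N) λ p → F p (N ℕ.∸ p)) ⟩
        fromℕ r * ∑< M (λ N → ∑< (suc N) λ p → F p (N ℕ.∸ p))
          ≈⟨ *-congˡ (∑-triangle M F) ⟩
        fromℕ r * ∑< M (λ p → ∑< (M ℕ.∸ p) (F p))
          -- Outside the triangle the last index `p + j + 1` exceeds `r + n`, so the range can be
          -- completed to a square.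
          ≈⟨ *-congˡ (∑-cong M λ p → ∑-extend (F p) (ℕₚ.m∸n≤m M p) λ j M∸p≤j →
               trans (*-congˡ (W-vanishes r (suc (p ℕ.+ j)) n (s≤s (ℕₚ.≤-trans (ℕₚ.m≤n+m∸n M p) (ℕₚ.+-monoʳ-≤ p M∸p≤j))))) (zeroʳ (g p j))) ⟩
        fromℕ r * ∑< M (λ p → ∑< M (F p)) ∎
        where
        F : ℕ → ℕ → Carrier
        F p j = g p j * T (suc (p ℕ.+ j))
        diagonal : ∀ N → fromℕ (r !) * (z N * ∑< (suc N) L) * T (suc N) ≈ fromℕ r * ∑< (suc N) (λ p → F p (N ℕ.∸ p))
        diagonal N = begin
          fromℕ (r !) * (z N * ∑< (suc N) L) * T (suc N)
            ≈⟨ *-congʳ (*-congʳ (fromℕ-* r (s !))) ⟩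
          fromℕ r * fromℕ (s !) * (z N * ∑< (suc N) L) * T (suc N)
            ≈⟨ solve 5 (λ r s z l t → r :* s :* (z :* l) :* t := r :* ((s :* z :* t) :* l)) refl
                 (fromℕ r) (fromℕ (s !)) (z N) (∑< (suc N) L) (T (suc N)) ⟩
          fromℕ r * (fromℕ (s !) * z N * T (suc N) * ∑< (suc N) L)
            ≈⟨ *-congˡ (∑-*ˡ (suc N) (fromℕ (s !) * z N * T (suc N)) L) ⟨
          fromℕ r * ∑< (suc N) (λ p → fromℕ (s !) * z N * T (suc N) * L p)
            ≈⟨ *-congˡ (∑-cong< (suc N) λ p p<1+N → trans
                 (solve 4 (λ s z t l → s :* z :* t :* l := s :* l :* z :* t) refl (fromℕ (s !)) (z N) (T (suc N)) (L p))
                 (reflexive (≡.cong (λ a → fromℕ (s !) * L p * z a * T (suc a)) (≡.sym (ℕₚ.m+[n∸m]≡n (ℕₚ.≤-pred p<1+N)))))) ⟩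
          fromℕ r * ∑< (suc N) (λ p → F p (N ℕ.∸ p)) ∎

      degMultiPolyBernoulli-Σₘ : degMultiPolyBernoulli lam lam≠0 r k⃗ n x ≈
        fromℕ r * ∑< (suc n) (λ k → ∑< (suc k) λ l → ∑< (suc l) λ j → Σₘ k l j)
      degMultiPolyBernoulli-Σₘ = begin
        degMultiPolyBernoulli lam lam≠0 r k⃗ n x
          ≈⟨ degMultiPolyBernoulli-∑ r k⃗ n (suc M) (ℕₚ.n<1+n M) ⟩
        fromℕ (n !) * ∑< (suc M) (λ N → fromℕ (r !) * Li r k⃗ N * T N)
          ≈⟨ *-congˡ ∑-Li-T ⟩
        fromℕ (n !) * (fromℕ r * ∑< M (λ p → ∑< M λ j → g p j * T (suc (p ℕ.+ j))))
          ≈⟨ *-swapˡ _ _ _ ⟩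
        fromℕ r * (fromℕ (n !) * ∑< M (λ p → ∑< M λ j → g p j * T (suc (p ℕ.+ j))))
          ≈⟨ *-congˡ ∑-Σₘ ⟨
        fromℕ r * ∑< (suc n) (λ k → ∑< (suc k) λ l → ∑< (suc l) λ j → Σₘ k l j) ∎

-- As the sum over m may diverge, `Σₘ` is specified by `_SumsTo_`, which determines it by
-- `SumsTo-unique` and gives the ordinary sum whenever there is one by `SumsTo-regular`.
theorem2 : ∀ {c ℓ₁ ℓ₂} (ℝ : RealField c ℓ₁ ℓ₂) →
  let open RealField ℝ
      open DegenerateBernoulli ℝ
  in
  (lam : Carrier) (lam≠0 : lam # 0#) (r-2 : ℕ) →
  let r = suc (suc r-2)
      β = degBernoulli lam lam≠0
      βᵐ = degMultiPolyBernoulli lam lam≠0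
  in
  (k⃗ : Vector ℤ r) (n : ℕ) (x : Carrier) →
  let kᵣ = last k⃗
      summand : ℕ → ℕ → ℕ → ℕ → Carrier
      summand k l nᵣ-1 m =
        let nᵣ = suc nᵣ-1 in
        binom (fromℤ (kᵣ ℤ.+ + m ℤ.- + 1)) m * fromℕ (k C l) * fromℕ (n C k) * (- 1#) ^ m
          * (fromℕ (nᵣ !) * -1^ (+ l ℤ.- + nᵣ ℤ.- + 1) * S₂ (suc l) nᵣ * 1/ suc l)
          * nᵣ ^ℤ (ℤ.- kᵣ ℤ.- + m)
          * β (n ℕ.∸ k)
          * βᵐ (suc r-2) (updateAt (init k⃗) (Fin.fromℕ r-2) (ℤ._- + m)) (k ℕ.∸ l) x
  in
  ∃ λ (Σₘ : ℕ → ℕ → ℕ → Carrier) →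
    (∀ k l nᵣ-1 → k ℕ.≤ n → l ℕ.≤ k → nᵣ-1 ℕ.≤ l →
      (summand k l nᵣ-1 SumsTo Σₘ k l nᵣ-1) ×
      (kᵣ ℤ.≤ + 0 → summand k l nᵣ-1 ConvergesTo Σₘ k l nᵣ-1)) ×
    βᵐ r k⃗ n x ≈
      fromℕ r * ∑< (suc n) λ k → ∑< (suc k) λ l → ∑< (suc l) λ nᵣ-1 → Σₘ k l nᵣ-1
theorem2 ℝ lam lam≠0 r-2 k⃗ n x = Σₘ ,
  (λ k l j k≤n _ _ → summand-SumsTo k l j k≤n , summand-ConvergesTo k l j k≤n) ,
  degMultiPolyBernoulli-Σₘ
  where
  open MultiPolyBernoulli ℝ lam lam≠0 x
  open Reduction r-2 k⃗ n
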